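{- For every integer $k>0$, $$\zeta_{\mathcal P}(\{2\}^k)=\sum_{\ell(\lambda)=k}\frac{1}{n_\lambda^2}=\frac{2^{2k-1}-1}{2^{2k-2}}\,\zeta(2k).$$ For example, $$\zeta_{\mathcal P}(\{2\})=\zeta(2)=\frac{\pi^2}{6},\quad \zeta_{\mathcal P}(\{2\}^2)=\frac74\zeta(4)=\frac{7\pi^4}{360},\quad \zeta_{\mathcal P}(\{2\}^3)=\frac{31}{16}\zeta(6)=\frac{31\pi^6}{15120},$$ $$\zeta_{\mathcal P}(\{2\}^{13})=\frac{33554431}{16777216}\zeta(26)=\frac{22076500342261\,\pi^{26}}{93067260259985915904000000}.$$
   Context: A partition is a finite non-increasing sequence $\lambda=(\lambda_1,\dots,\lambda_r)$ of positive integers (including the empty partition, $r=0$); its length is $\ell(\lambda):=r$ and its integer is $n_\lambda:=\lambda_1\lambda_2\cdots\lambda_r$ (with $n_\emptyset:=1$). For $\operatorname{Re}(s)>1$ and an integer $k\ge0$, $\zeta_{\mathcal P}(\{s\}^k):=\sum_{\ell(\lambda)=k}n_\lambda^{ -s}$, the sum being over all partitions of length exactly $k$; $\zeta_{\mathcal P}(\{s\})$ means $\zeta_{\mathcal P}(\{s\}^1)$. $\zeta$ is the Riemann zeta function. -}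

module Defs where

open import Data.Integer.Base as ℤ using (ℤ; +_; -1ℤ)
import Data.Integer.Properties as ℤP
open import Data.List.Base using (List; []; _∷_; length; map; foldr; applyUpTo)
open import Data.List.Relation.Binary.Subset.Propositional using (_⊆_)
open import Data.List.Relation.Unary.All using (All)
open import Data.List.Relation.Unary.Linked using (Linked)
open import Data.List.Relation.Unary.Unique.Propositional using (Unique)
open import Data.Nat.Base as ℕ using (ℕ; zero; suc; NonZero; NonTrivial)
open import Data.Nat.ListAction using (product)
open import Data.Nat.ListAction.Properties using (product≢0)
import Data.Nat.Properties as ℕP
open import Data.Nat.Solver using (module +-*-Solver)
open import Data.Product.Base using (Σ; ∃; _×_; _,_; proj₁; proj₂)
open import Data.Rational.Base as ℚ using (ℚ; 0ℚ; 1ℚ; ½; mkℚ; toℚᵘ; _/_)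
import Data.Rational.Properties as ℚP
open import Data.Rational.Solver using () renaming (module +-*-Solver to ℚ-Solver)
open import Data.Rational.Unnormalised.Base as ℚᵘ using (mkℚᵘ; *≤*; *≡*)
import Data.Rational.Unnormalised.Properties as ℚᵘP
open import Relation.Binary.PropositionalEquality

-- Reals are Cauchy sequences of rationals; equality of reals is _≃_, not _≡_.

Cauchy : (ℕ → ℚ) → Set
Cauchy f = ∀ ε → 0ℚ ℚ.< ε → ∃ λ N → ∀ m n → N ℕ.≤ m → N ℕ.≤ n → ℚ.∣ f m ℚ.- f n ∣ ℚ.≤ ε

record ℝ : Set where
  constructor mkℝ
  field
    approx : ℕ → ℚ
    cauchy : Cauchy approx

open ℝ public

infix 4 _≃_

_≃_ : ℝ → ℝ → Set
x ≃ y = ∀ ε → 0ℚ ℚ.< ε → ∃ λ N → ∀ n → N ℕ.≤ n → ℚ.∣ approx x n ℚ.- approx y n ∣ ℚ.≤ ε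

module ℝ-lemmas where

  toℚᵘ-/ : ∀ a b → toℚᵘ (a / suc b) ℚᵘ.≃ mkℚᵘ a b
  toℚᵘ-/ a b = ℚP.toℚᵘ-fromℚᵘ (mkℚᵘ a b)

  /-mono : ∀ a b c d → a ℕ.* suc d ℕ.≤ c ℕ.* suc b → + a / suc b ℚ.≤ + c / suc d
  /-mono a b c d h = ℚP.toℚᵘ-cancel-≤
    (ℚᵘP.≤-respˡ-≃ (ℚᵘP.≃-sym (toℚᵘ-/ (+ a) b))
      (ℚᵘP.≤-respʳ-≃ (ℚᵘP.≃-sym (toℚᵘ-/ (+ c) d))
        (*≤* (subst₂ ℤ._≤_ (ℤP.pos-* a (suc d)) (ℤP.pos-* c (suc b)) (ℤ.+≤+ h)))))

  /-+ : ∀ a b c d → + a / suc b ℚ.+ + c / suc d ≡ + (a ℕ.* suc d ℕ.+ c ℕ.* suc b) / (suc b ℕ.* suc d)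
  /-+ a b c d = ℚP.toℚᵘ-injective (ℚᵘP.≃-trans (ℚP.toℚᵘ-homo-+ (+ a / suc b) (+ c / suc d))
    (ℚᵘP.≃-trans (ℚᵘP.+-cong (toℚᵘ-/ (+ a) b) (toℚᵘ-/ (+ c) d))
      (ℚᵘP.≃-trans (*≡* (cong (ℤ._* + (suc b ℕ.* suc d)) (cong₂ ℤ._+_ (sym (ℤP.pos-* a (suc d))) (sym (ℤP.pos-* c (suc b))))))
        (ℚᵘP.≃-sym (toℚᵘ-/ (+ (a ℕ.* suc d ℕ.+ c ℕ.* suc b)) (d ℕ.+ b ℕ.* suc d))))))

  0≤/ : ∀ a b → 0ℚ ℚ.≤ + a / suc b
  0≤/ a b = /-mono 0 0 a b ℕ.z≤n

  ½+½ : ∀ q → ½ ℚ.* q ℚ.+ ½ ℚ.* q ≡ q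
  ½+½ q = trans (sym (ℚP.*-distribʳ-+ q ½ ½)) (ℚP.*-identityˡ q)

  0<½* : ∀ {q} → 0ℚ ℚ.< q → 0ℚ ℚ.< ½ ℚ.* q
  0<½* {q} h = subst (ℚ._< ½ ℚ.* q) (ℚP.*-zeroʳ ½) (ℚP.*-monoʳ-<-pos ½ {0ℚ} {q} h)

  archimedean : ∀ ε → 0ℚ ℚ.< ε → ∃ λ N → + 4 / suc N ℚ.≤ ε
  archimedean ε@(mkℚ (+ suc p) d _) _ = 4 ℕ.* suc d , ℚP.toℚᵘ-cancel-≤
    (ℚᵘP.≤-respˡ-≃ (ℚᵘP.≃-sym (toℚᵘ-/ (+ 4) (4 ℕ.* suc d)))
      (*≤* (subst₂ ℤ._≤_ (ℤP.pos-* 4 (suc d)) (ℤP.pos-* (suc p) (suc (4 ℕ.* suc d)))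
        (ℤ.+≤+ (ℕP.≤-trans (ℕP.n≤1+n (4 ℕ.* suc d)) (ℕP.m≤n*m (suc (4 ℕ.* suc d)) (suc p)))))))
  archimedean (mkℚ (+ zero) d _) (ℚ.*<* (ℤ.+<+ ()))
  archimedean (mkℚ ℤ.-[1+ p ] d _) (ℚ.*<* ())

  ∣-∣-swap : ∀ p q → ℚ.∣ p ℚ.- q ∣ ≡ ℚ.∣ q ℚ.- p ∣
  ∣-∣-swap p q = trans (cong ℚ.∣_∣ (ℚ-Solver.solve 2 (λ p q → p :- q := :- (q :- p)) refl p q)) (ℚP.∣-p∣≡∣p∣ (q ℚ.- p))
    where open ℚ-Solver

  rate⇒Cauchy : ∀ f → (∀ n d → ℚ.∣ f (n ℕ.+ d) ℚ.- f n ∣ ℚ.≤ + 4 / suc n) → Cauchy f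
  rate⇒Cauchy f rate ε 0<ε with archimedean (½ ℚ.* ε) (0<½* 0<ε)
  ... | N , 4/N≤ = N , λ m n N≤m N≤n → begin
    ℚ.∣ f m ℚ.- f n ∣                                 ≡⟨ cong ℚ.∣_∣ (lem (f m) (f n) (f N)) ⟩
    ℚ.∣ (f m ℚ.- f N) ℚ.+ (f N ℚ.- f n) ∣             ≤⟨ ℚP.∣p+q∣≤∣p∣+∣q∣ (f m ℚ.- f N) (f N ℚ.- f n) ⟩
    ℚ.∣ f m ℚ.- f N ∣ ℚ.+ ℚ.∣ f N ℚ.- f n ∣           ≡⟨ cong (ℚ.∣ f m ℚ.- f N ∣ ℚ.+_) (∣-∣-swap (f N) (f n)) ⟩
    ℚ.∣ f m ℚ.- f N ∣ ℚ.+ ℚ.∣ f n ℚ.- f N ∣           ≤⟨ ℚP.+-mono-≤ (near m N≤m) (near n N≤n) ⟩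
    ½ ℚ.* ε ℚ.+ ½ ℚ.* ε                               ≡⟨ ½+½ ε ⟩
    ε                                                 ∎
    where
    open ℚP.≤-Reasoning
    lem : ∀ p q r → p ℚ.- q ≡ (p ℚ.- r) ℚ.+ (r ℚ.- q)
    lem = ℚ-Solver.solve 3 (λ p q r → p :- q := (p :- r) :+ (r :- q)) refl
      where open ℚ-Solver
    near : ∀ m → N ℕ.≤ m → ℚ.∣ f m ℚ.- f N ∣ ℚ.≤ ½ ℚ.* ε
    near m N≤m = subst (λ k → ℚ.∣ f k ℚ.- f N ∣ ℚ.≤ ½ ℚ.* ε) (ℕP.m+[n∸m]≡n N≤m) (ℚP.≤-trans (rate N (m ℕ.∸ N)) 4/N≤)

  bound : ∀ f → Cauchy f → ∃ λ N → ∃ λ B → 0ℚ ℚ.< B × (∀ n → N ℕ.≤ n → ℚ.∣ f n ∣ ℚ.≤ B)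
  bound f c with c 1ℚ (ℚP.positive⁻¹ 1ℚ)
  ... | N , h = N , ℚ.∣ f N ∣ ℚ.+ 1ℚ , ℚP.+-mono-≤-< (ℚP.0≤∣p∣ (f N)) (ℚP.positive⁻¹ 1ℚ) , λ n N≤n → begin
    ℚ.∣ f n ∣                           ≡⟨ cong ℚ.∣_∣ (lem (f n) (f N)) ⟩
    ℚ.∣ f N ℚ.+ (f n ℚ.- f N) ∣         ≤⟨ ℚP.∣p+q∣≤∣p∣+∣q∣ (f N) (f n ℚ.- f N) ⟩
    ℚ.∣ f N ∣ ℚ.+ ℚ.∣ f n ℚ.- f N ∣     ≤⟨ ℚP.+-monoʳ-≤ ℚ.∣ f N ∣ (h n N N≤n ℕP.≤-refl) ⟩
    ℚ.∣ f N ∣ ℚ.+ 1ℚ                    ∎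
    where
    open ℚP.≤-Reasoning
    lem : ∀ p q → p ≡ q ℚ.+ (p ℚ.- q)
    lem = ℚ-Solver.solve 2 (λ p q → p := q :+ (p :- q)) refl
      where open ℚ-Solver

  divide : ∀ K ε → 0ℚ ℚ.< K → 0ℚ ℚ.< ε → ∃ λ δ → 0ℚ ℚ.< δ × K ℚ.* δ ≡ ε
  divide K ε 0<K 0<ε = r ℚ.* ε , 0<δ , (begin
    K ℚ.* (r ℚ.* ε)   ≡⟨ ℚP.*-assoc K r ε ⟨
    K ℚ.* r ℚ.* ε     ≡⟨ cong (ℚ._* ε) (ℚP.*-inverseʳ K {{K≢0}}) ⟩
    1ℚ ℚ.* ε          ≡⟨ ℚP.*-identityˡ ε ⟩
    ε                 ∎)
    where
    open ≡-Reasoning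
    K≢0 : ℚ.NonZero K
    K≢0 = ℚP.pos⇒nonZero K {{ℚ.positive 0<K}}
    r : ℚ
    r = (ℚ.1/ K) {{K≢0}}
    0<δ : 0ℚ ℚ.< r ℚ.* ε
    0<δ = ℚP.positive⁻¹ (r ℚ.* ε) {{ℚP.pos*pos⇒pos r {{ℚP.1/pos⇒pos K {{ℚ.positive 0<K}}}} ε {{ℚ.positive 0<ε}}}}

  *-mono-≤ : ∀ p q r s → 0ℚ ℚ.≤ r → 0ℚ ℚ.≤ q → p ℚ.≤ q → r ℚ.≤ s → p ℚ.* r ℚ.≤ q ℚ.* s
  *-mono-≤ p q r s 0≤r 0≤q p≤q r≤s = ℚP.≤-trans {p ℚ.* r} {q ℚ.* r} {q ℚ.* s}
    (ℚP.*-monoʳ-≤-nonNeg r {{ℚ.nonNegative 0≤r}} {p} {q} p≤q)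
    (ℚP.*-monoˡ-≤-nonNeg q {{ℚ.nonNegative 0≤q}} {r} {s} r≤s)

  ∣ab-cd∣≤ : ∀ a b c d B C δ → 0ℚ ℚ.≤ B → 0ℚ ℚ.≤ C → ℚ.∣ a ∣ ℚ.≤ B → ℚ.∣ d ∣ ℚ.≤ C →
    ℚ.∣ b ℚ.- d ∣ ℚ.≤ δ → ℚ.∣ a ℚ.- c ∣ ℚ.≤ δ → ℚ.∣ a ℚ.* b ℚ.- c ℚ.* d ∣ ℚ.≤ (B ℚ.+ C) ℚ.* δ
  ∣ab-cd∣≤ a b c d B C δ 0≤B 0≤C a≤B d≤C b-d≤δ a-c≤δ = begin
    ℚ.∣ a ℚ.* b ℚ.- c ℚ.* d ∣                                     ≡⟨ cong ℚ.∣_∣ (lem a b c d) ⟩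
    ℚ.∣ a ℚ.* (b ℚ.- d) ℚ.+ d ℚ.* (a ℚ.- c) ∣                     ≤⟨ ℚP.∣p+q∣≤∣p∣+∣q∣ (a ℚ.* (b ℚ.- d)) (d ℚ.* (a ℚ.- c)) ⟩
    ℚ.∣ a ℚ.* (b ℚ.- d) ∣ ℚ.+ ℚ.∣ d ℚ.* (a ℚ.- c) ∣               ≡⟨ cong₂ ℚ._+_ (ℚP.∣p*q∣≡∣p∣*∣q∣ a (b ℚ.- d)) (ℚP.∣p*q∣≡∣p∣*∣q∣ d (a ℚ.- c)) ⟩
    ℚ.∣ a ∣ ℚ.* ℚ.∣ b ℚ.- d ∣ ℚ.+ ℚ.∣ d ∣ ℚ.* ℚ.∣ a ℚ.- c ∣       ≤⟨ ℚP.+-mono-≤ (*-mono-≤ ℚ.∣ a ∣ B ℚ.∣ b ℚ.- d ∣ δ (ℚP.0≤∣p∣ (b ℚ.- d)) 0≤B a≤B b-d≤δ)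
                                                                                  (*-mono-≤ ℚ.∣ d ∣ C ℚ.∣ a ℚ.- c ∣ δ (ℚP.0≤∣p∣ (a ℚ.- c)) 0≤C d≤C a-c≤δ) ⟩
    B ℚ.* δ ℚ.+ C ℚ.* δ                                           ≡⟨ ℚP.*-distribʳ-+ δ B C ⟨
    (B ℚ.+ C) ℚ.* δ                                               ∎
    where
    open ℚP.≤-Reasoning
    lem : ∀ a b c d → a ℚ.* b ℚ.- c ℚ.* d ≡ a ℚ.* (b ℚ.- d) ℚ.+ d ℚ.* (a ℚ.- c)
    lem = ℚ-Solver.solve 4 (λ a b c d → a :* b :- c :* d := a :* (b :- d) :+ d :* (a :- c)) refl
      where open ℚ-Solver

  *-Cauchy : ∀ f g → Cauchy f → Cauchy g → Cauchy (λ n → f n ℚ.* g n)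
  *-Cauchy f g cf cg ε 0<ε =
    let (M  , B , 0<B , f≤B) = bound f cf
        (M′ , C , 0<C , g≤C) = bound g cg
        (δ , 0<δ , Kδ≡ε)     = divide (B ℚ.+ C) ε (ℚP.+-mono-< 0<B 0<C) 0<ε
        (P , hf)             = cf δ 0<δ
        (Q , hg)             = cg δ 0<δ
    in combine M M′ P Q λ m n M≤m M′≤n P≤m P≤n Q≤m Q≤n →
         subst (ℚ.∣ f m ℚ.* g m ℚ.- f n ℚ.* g n ∣ ℚ.≤_) Kδ≡ε
           (∣ab-cd∣≤ (f m) (g m) (f n) (g n) B C δ (ℚP.<⇒≤ 0<B) (ℚP.<⇒≤ 0<C)
             (f≤B m M≤m) (g≤C n M′≤n) (hg m n Q≤m Q≤n) (hf m n P≤m P≤n))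
    where
    combine : ∀ {R : ℕ → ℕ → Set} M M′ P Q →
      (∀ m n → M ℕ.≤ m → M′ ℕ.≤ n → P ℕ.≤ m → P ℕ.≤ n → Q ℕ.≤ m → Q ℕ.≤ n → R m n) →
      ∃ λ N → ∀ m n → N ℕ.≤ m → N ℕ.≤ n → R m n
    combine M M′ P Q h = N , λ m n N≤m N≤n → h m n (≤₁ N≤m) (≤₂ N≤n) (≤₃ N≤m) (≤₃ N≤n) (≤₄ N≤m) (≤₄ N≤n)
      where
      N = (M ℕ.⊔ M′) ℕ.⊔ (P ℕ.⊔ Q)
      ≤₁ : ∀ {n} → N ℕ.≤ n → M ℕ.≤ n
      ≤₁ h = ℕP.m⊔n≤o⇒m≤o M M′ (ℕP.m⊔n≤o⇒m≤o (M ℕ.⊔ M′) (P ℕ.⊔ Q) h)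
      ≤₂ : ∀ {n} → N ℕ.≤ n → M′ ℕ.≤ n
      ≤₂ h = ℕP.m⊔n≤o⇒n≤o M M′ (ℕP.m⊔n≤o⇒m≤o (M ℕ.⊔ M′) (P ℕ.⊔ Q) h)
      ≤₃ : ∀ {n} → N ℕ.≤ n → P ℕ.≤ n
      ≤₃ h = ℕP.m⊔n≤o⇒m≤o P Q (ℕP.m⊔n≤o⇒n≤o (M ℕ.⊔ M′) (P ℕ.⊔ Q) h)
      ≤₄ : ∀ {n} → N ℕ.≤ n → Q ℕ.≤ n
      ≤₄ h = ℕP.m⊔n≤o⇒n≤o P Q (ℕP.m⊔n≤o⇒n≤o (M ℕ.⊔ M′) (P ℕ.⊔ Q) h)

open ℝ-lemmas

fromℚ : ℚ → ℝ
fromℚ q = mkℝ (λ _ → q) λ ε 0<ε → 0 , λ _ _ _ _ →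
  subst (λ p → ℚ.∣ p ∣ ℚ.≤ ε) (sym (ℚP.+-inverseʳ q)) (ℚP.<⇒≤ 0<ε)

infixl 7 _*_
infixr 8 _^_

_*_ : ℝ → ℝ → ℝ
x * y = mkℝ (λ n → approx x n ℚ.* approx y n) (*-Cauchy (approx x) (approx y) (cauchy x) (cauchy y))

_^_ : ℝ → ℕ → ℝ
x ^ zero  = fromℚ 1ℚ
x ^ suc n = x * x ^ n

sum : List ℚ → ℚ
sum = foldr ℚ._+_ 0ℚ

partialSum : (ℕ → ℚ) → ℕ → ℚ
partialSum f n = sum (applyUpTo f n)

module partialSum-lemmas where

  partialSum-cong : ∀ {f g} → (∀ i → f i ≡ g i) → ∀ n → partialSum f n ≡ partialSum g n
  partialSum-cong f≗g zero    = refl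
  partialSum-cong f≗g (suc n) = cong₂ ℚ._+_ (f≗g 0) (partialSum-cong (λ i → f≗g (suc i)) n)

  partialSum-neg : ∀ f n → partialSum (λ i → ℚ.- f i) n ≡ ℚ.- partialSum f n
  partialSum-neg f zero    = refl
  partialSum-neg f (suc n) = trans (cong (ℚ.- f 0 ℚ.+_) (partialSum-neg (λ i → f (suc i)) n)) (sym (ℚP.neg-distrib-+ (f 0) _))

  partialSum-tail : ∀ f n d → partialSum f (n ℕ.+ d) ℚ.- partialSum f n ≡ partialSum (λ i → f (n ℕ.+ i)) d
  partialSum-tail f zero    d = ℚP.+-identityʳ _
  partialSum-tail f (suc n) d = trans (lem (f 0) _ _) (partialSum-tail (λ i → f (suc i)) n d)
    where
    lem : ∀ a b c → (a ℚ.+ b) ℚ.- (a ℚ.+ c) ≡ b ℚ.- c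
    lem = ℚ-Solver.solve 3 (λ a b c → (a :+ b) :- (a :+ c) := b :- c) refl
      where open ℚ-Solver

open partialSum-lemmas

1/_^_ : (n s : ℕ) .{{_ : NonZero n}} → ℚ
1/ n ^ s = (+ 1 / n ℕ.^ s) {{ℕP.m^n≢0 n s}}

module ζ-lemmas where

  /-mono′ : ∀ a b c d .{{_ : NonZero b}} .{{_ : NonZero d}} → a ℕ.* d ℕ.≤ c ℕ.* b → + a / b ℚ.≤ + c / d
  /-mono′ a (suc b) c (suc d) = /-mono a b c d

  1/^≤1/² : ∀ n s → 2 ℕ.≤ s → 1/ suc n ^ s ℚ.≤ + 1 / (suc n ℕ.* suc n)
  1/^≤1/² n s 2≤s = /-mono′ 1 (suc n ℕ.^ s) 1 (suc n ℕ.* suc n) {{ℕP.m^n≢0 (suc n) s}}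
    (subst₂ ℕ._≤_ (trans (cong (suc n ℕ.*_) (ℕP.*-identityʳ (suc n))) (sym (ℕP.*-identityˡ _))) (sym (ℕP.*-identityˡ _))
      (ℕP.^-monoʳ-≤ (suc n) 2≤s))

  0≤1/^ : ∀ n s → 0ℚ ℚ.≤ 1/ suc n ^ s
  0≤1/^ n s = /-mono′ 0 1 1 (suc n ℕ.^ s) {{_}} {{ℕP.m^n≢0 (suc n) s}} ℕ.z≤n

  step : ∀ n → + 1 / (suc n ℕ.* suc n) ℚ.+ + 2 / suc (suc n) ℚ.≤ + 2 / suc n
  step n = subst (ℚ._≤ + 2 / suc n) (sym (/-+ 1 (n ℕ.+ n ℕ.* suc n) 2 (suc n)))
    (/-mono′ (1 ℕ.* suc (suc n) ℕ.+ 2 ℕ.* (suc n ℕ.* suc n)) ((suc n ℕ.* suc n) ℕ.* suc (suc n)) 2 (suc n) (subst₂ ℕ._≤_ (lemˡ n) (lemʳ n) (ℕP.m≤m+n _ (suc n ℕ.* n))))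
    where
    open +-*-Solver
    lemˡ : ∀ n → suc n ℕ.* (suc (suc n) ℕ.+ 2 ℕ.* (suc n ℕ.* suc n)) ≡ (1 ℕ.* suc (suc n) ℕ.+ 2 ℕ.* (suc n ℕ.* suc n)) ℕ.* suc n
    lemˡ = solve 1 (λ n → let m = con 1 :+ n in m :* ((con 1 :+ m) :+ con 2 :* (m :* m)) := (con 1 :* (con 1 :+ m) :+ con 2 :* (m :* m)) :* m) refl
    lemʳ : ∀ n → suc n ℕ.* (suc (suc n) ℕ.+ 2 ℕ.* (suc n ℕ.* suc n)) ℕ.+ suc n ℕ.* n ≡ 2 ℕ.* ((suc n ℕ.* suc n) ℕ.* suc (suc n))
    lemʳ = solve 1 (λ n → let m = con 1 :+ n in m :* ((con 1 :+ m) :+ con 2 :* (m :* m)) :+ m :* n := con 2 :* ((m :* m) :* (con 1 :+ m))) refl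

  ζ-tail : ∀ (f : ℕ → ℚ) n → (∀ i → f i ℚ.≤ + 1 / (suc (i ℕ.+ n) ℕ.* suc (i ℕ.+ n))) → ∀ d → partialSum f d ℚ.≤ + 2 / suc n
  ζ-tail f n h zero    = 0≤/ 2 n
  ζ-tail f n h (suc d) = ℚP.≤-trans
    (ℚP.+-mono-≤ (h 0) (ζ-tail (λ i → f (suc i)) (suc n) (λ i → subst (λ k → f (suc i) ℚ.≤ + 1 / (suc k ℕ.* suc k)) (sym (ℕP.+-suc i n)) (h (suc i))) d))
    (step n)

  partialSum-nonNeg : ∀ f → (∀ i → 0ℚ ℚ.≤ f i) → ∀ d → 0ℚ ℚ.≤ partialSum f d
  partialSum-nonNeg f h zero    = ℚP.≤-refl
  partialSum-nonNeg f h (suc d) = ℚP.+-mono-≤ (h 0) (partialSum-nonNeg (λ i → f (suc i)) (λ i → h (suc i)) d)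

  ζ-Cauchy : ∀ s → 2 ℕ.≤ s → Cauchy (partialSum (λ i → 1/ suc i ^ s))
  ζ-Cauchy s 2≤s = rate⇒Cauchy (partialSum f) λ n d → begin
    ℚ.∣ partialSum f (n ℕ.+ d) ℚ.- partialSum f n ∣   ≡⟨ cong ℚ.∣_∣ (partialSum-tail f n d) ⟩
    ℚ.∣ partialSum (λ i → f (n ℕ.+ i)) d ∣            ≡⟨ ℚP.0≤p⇒∣p∣≡p (partialSum-nonNeg (λ i → f (n ℕ.+ i)) (λ i → 0≤1/^ (n ℕ.+ i) s) d) ⟩
    partialSum (λ i → f (n ℕ.+ i)) d                  ≤⟨ ζ-tail (λ i → f (n ℕ.+ i)) n (λ i → subst (λ k → f (n ℕ.+ i) ℚ.≤ + 1 / (suc k ℕ.* suc k)) (ℕP.+-comm n i) (1/^≤1/² (n ℕ.+ i) s 2≤s)) d ⟩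
    + 2 / suc n                                       ≤⟨ /-mono 2 n 4 n (ℕP.*-monoˡ-≤ (suc n) (ℕ.s≤s (ℕ.s≤s (ℕ.z≤n {2})))) ⟩
    + 4 / suc n                                       ∎
    where
    open ℚP.≤-Reasoning
    f = λ i → 1/ suc i ^ s

open ζ-lemmas

-- The Riemann zeta function at the integers s ≥ 2, where it is Σ_{n ≥ 1} n⁻ˢ.

ζ : (s : ℕ) .{{_ : NonTrivial s}} → ℝ
ζ s = mkℝ (partialSum (λ i → 1/ suc i ^ s)) (ζ-Cauchy s (ℕ.nonTrivial⇒n>1 s))

2*k-nonTrivial : ∀ k .{{_ : NonZero k}} → NonTrivial (2 ℕ.* k)
2*k-nonTrivial (suc k) = subst NonTrivial (cong suc (sym (ℕP.+-suc k (k ℕ.+ 0)))) _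

leibnizTerm : ℕ → ℚ
leibnizTerm i = (-1ℤ ℤ.^ i) / suc (2 ℕ.* i)

module π-lemmas where

  alt : ℕ → ℚ → ℚ
  alt zero    q = q
  alt (suc i) q = ℚ.- alt i q

  /-neg : ∀ i n .{{_ : NonZero n}} → (ℤ.- i) / n ≡ ℚ.- (i / n)
  /-neg (+ zero)   n = trans (ℚP.0/n≡0 n) (cong ℚ.-_ (sym (ℚP.0/n≡0 n)))
  /-neg (+ suc i)  n = refl
  /-neg ℤ.-[1+ i ] n = neg-neg (+ suc i / n)
    where
    neg-neg : ∀ q → q ≡ ℚ.- ℚ.- q
    neg-neg = ℚ-Solver.solve 1 (λ q → q := :- (:- q)) refl
      where open ℚ-Solver

  /-alt : ∀ i n .{{_ : NonZero n}} → (-1ℤ ℤ.^ i) / n ≡ alt i (+ 1 / n)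
  /-alt zero    n = refl
  /-alt (suc i) n = trans (cong (λ z → z / n) (ℤP.-1*i≡-i (-1ℤ ℤ.^ i))) (trans (/-neg (-1ℤ ℤ.^ i) n) (cong ℚ.-_ (/-alt i n)))

  ∣alt∣ : ∀ i q → ℚ.∣ alt i q ∣ ≡ ℚ.∣ q ∣
  ∣alt∣ zero    q = refl
  ∣alt∣ (suc i) q = trans (ℚP.∣-p∣≡∣p∣ (alt i q)) (∣alt∣ i q)

  alt-sum : ∀ (f : ℕ → ℚ) n d → partialSum (λ i → alt (n ℕ.+ i) (f i)) d ≡ alt n (partialSum (λ i → alt i (f i)) d)
  alt-sum f zero    d = refl
  alt-sum f (suc n) d = trans (partialSum-neg (λ i → alt (n ℕ.+ i) (f i)) d) (cong ℚ.-_ (alt-sum f n d))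

  p-q≤p : ∀ p q → 0ℚ ℚ.≤ q → p ℚ.- q ℚ.≤ p
  p-q≤p p q h = subst (p ℚ.- q ℚ.≤_) (ℚP.+-identityʳ p) (ℚP.+-monoʳ-≤ p (ℚP.neg-antimono-≤ h))

  0≤p-q : ∀ p q → q ℚ.≤ p → 0ℚ ℚ.≤ p ℚ.- q
  0≤p-q p q h = subst (ℚ._≤ p ℚ.- q) (ℚP.+-inverseʳ q) (ℚP.+-monoˡ-≤ (ℚ.- q) h)

  alternating : ∀ (a : ℕ → ℚ) → (∀ i → 0ℚ ℚ.≤ a i) → (∀ i → a (suc i) ℚ.≤ a i) → ∀ d →
    0ℚ ℚ.≤ partialSum (λ i → alt i (a i)) d × partialSum (λ i → alt i (a i)) d ℚ.≤ a 0
  alternating a 0≤a dec zero    = ℚP.≤-refl , 0≤a 0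
  alternating a 0≤a dec (suc d) with alternating (λ i → a (suc i)) (λ i → 0≤a (suc i)) (λ i → dec (suc i)) d
  ... | lo , hi = subst (0ℚ ℚ.≤_) (sym eq) (0≤p-q (a 0) T (ℚP.≤-trans hi (dec 0)))
                , subst (ℚ._≤ a 0) (sym eq) (p-q≤p (a 0) T lo)
    where
    T = partialSum (λ i → alt i (a (suc i))) d
    eq : partialSum (λ i → alt i (a i)) (suc d) ≡ a 0 ℚ.- T
    eq = cong (a 0 ℚ.+_) (partialSum-neg (λ i → alt i (a (suc i))) d)

  leibniz-tail : ∀ n d → ℚ.∣ partialSum leibnizTerm (n ℕ.+ d) ℚ.- partialSum leibnizTerm n ∣ ℚ.≤ + 1 / suc n
  leibniz-tail n d = begin
    ℚ.∣ partialSum leibnizTerm (n ℕ.+ d) ℚ.- partialSum leibnizTerm n ∣  ≡⟨ cong ℚ.∣_∣ (partialSum-tail leibnizTerm n d) ⟩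
    ℚ.∣ partialSum (λ i → leibnizTerm (n ℕ.+ i)) d ∣                     ≡⟨ cong ℚ.∣_∣ (partialSum-cong (λ i → /-alt (n ℕ.+ i) (suc (2 ℕ.* (n ℕ.+ i)))) d) ⟩
    ℚ.∣ partialSum (λ i → alt (n ℕ.+ i) (a i)) d ∣                       ≡⟨ cong ℚ.∣_∣ (alt-sum a n d) ⟩
    ℚ.∣ alt n (partialSum (λ i → alt i (a i)) d) ∣                       ≡⟨ ∣alt∣ n (partialSum (λ i → alt i (a i)) d) ⟩
    ℚ.∣ partialSum (λ i → alt i (a i)) d ∣                               ≡⟨ ℚP.0≤p⇒∣p∣≡p (proj₁ bounds) ⟩
    partialSum (λ i → alt i (a i)) d                                     ≤⟨ proj₂ bounds ⟩
    a 0                                                                  ≤⟨ /-mono 1 (2 ℕ.* (n ℕ.+ 0)) 1 n (ℕP.*-monoʳ-≤ 1 (ℕ.s≤s (ℕP.≤-trans (ℕP.m≤m+n n 0) (ℕP.m≤n*m (n ℕ.+ 0) 2)))) ⟩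
    + 1 / suc n                                                          ∎
    where
    open ℚP.≤-Reasoning
    a : ℕ → ℚ
    a i = + 1 / suc (2 ℕ.* (n ℕ.+ i))
    bounds = alternating a (λ i → 0≤/ 1 (2 ℕ.* (n ℕ.+ i)))
      (λ i → /-mono 1 (2 ℕ.* (n ℕ.+ suc i)) 1 (2 ℕ.* (n ℕ.+ i)) (ℕP.*-monoʳ-≤ 1 (ℕ.s≤s (ℕP.*-monoʳ-≤ 2 (ℕP.+-monoʳ-≤ n (ℕP.n≤1+n i)))))) d

open π-lemmas

-- Defined as 4 · arctan 1, arctan 1 being given by its Taylor series Σ (-1)ⁱ / (2i + 1).

π : ℝ
π = fromℚ (+ 4 / 1) * mkℝ (partialSum leibnizTerm) (rate⇒Cauchy (partialSum leibnizTerm) λ n d →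
  ℚP.≤-trans (leibniz-tail n d) (/-mono 1 n 4 n (ℕP.*-monoˡ-≤ (suc n) (ℕ.s≤s (ℕ.z≤n {3})))))

-- Both proof fields are mere propositions, so Partition has no repetitions:
-- partitions with the same parts are propositionally equal.

record Partition : Set where
  constructor mkPartition
  field
    parts         : List ℕ
    positive      : All NonZero parts
    nonIncreasing : Linked ℕ._≥_ parts

open Partition public

ℓ : Partition → ℕ
ℓ p = length (parts p)

-- n_λ
integer : Partition → ℕ
integer p = product (parts p)

integer≢0 : ∀ p → NonZero (integer p)
integer≢0 p = product≢0 (positive p)

-- Unconditional summation of a rational-valued family over an arbitrary index
-- type: the net of sums over finite sets of indices, represented by
-- duplicate-free lists, converges to x.  The innermost ∃ λ N says that the
-- rational finite sum is within ε of the real x.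

IsSum : {A : Set} → (A → ℚ) → ℝ → Set
IsSum {A} f x = ∀ ε → 0ℚ ℚ.< ε → ∃ λ (S : List A) → ∀ (T : List A) → Unique T → S ⊆ T →
  ∃ λ N → ∀ n → N ℕ.≤ n → ℚ.∣ sum (map f T) ℚ.- approx x n ∣ ℚ.≤ ε

-- ζ𝒫[ s ^ k ]≔ x  states that the series ζ_𝒫({s}ᵏ) = Σ_{ℓ(λ) = k} n_λ⁻ˢ
-- converges and that its value is x.

ζ𝒫[_^_]≔_ : ℕ → ℕ → ℝ → Set
ζ𝒫[ s ^ k ]≔ x = IsSum {Σ Partition λ p → ℓ p ≡ k} (λ (p , _) → (1/ integer p ^ s) {{integer≢0 p}}) x

{-# OPTIONS --safe #-}
module Submission where

-- The complete homogeneous symmetric polynomials h k N of 1, 1/2², …, 1/N² are the sums over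
-- partitions of length k with parts ≤ N. Expanding ∏ (1 - x²/n²)⁻¹ over n ≤ N in partial fractions,
-- h k N = 2 Σ (-1)ⁿ⁻¹ w N n / n²ᵏ over 1 ≤ n ≤ N, where w N n = (N!)² / ((N - n)! (N + n)!) increases
-- to 1 with N. Dominated convergence yields 2 Σ (-1)ⁿ⁻¹ / n²ᵏ, a rational multiple of ζ (2k).
--
-- Since h k = c ζ (2k) with c ≠ 1/k for k ≥ 2, Newton's identity k h k = Σ pᵢ h (k - i) becomes a
-- recursion expressing ζ (2k) through ζ 2. For ζ 2 itself, the square of the Leibniz sum of
-- Σ (-1)ⁱ / (2i + 1) differs from half the sum of 1/(2i + 1)² by an explicit remainder that tends to 0.
open import Data.Bool.Properties using (T-irrelevant)
open import Data.Empty using (⊥-elim)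
open import Data.Integer.Base as ℤ using (+_)
import Data.Integer.Properties as ℤP
open import Data.List.Base using (List; []; _∷_; _++_; length; map)
open import Data.List.Membership.Propositional using (_∈_)
open import Data.List.Membership.Propositional.Properties
  using (∈-∃++; ∈-++⁺ˡ; ∈-++⁺ʳ; ∈-++⁻; ∈-map⁺; ∈-map⁻)
open import Data.List.Properties using (map-++; ∷-injectiveʳ)
open import Data.List.Relation.Binary.Subset.Propositional using (_⊆_)
import Data.List.Relation.Binary.Subset.Propositional.Properties as ⊆
open import Data.List.Relation.Unary.All as All using (All; []; _∷_)
import Data.List.Relation.Unary.All.Properties as All
open import Data.List.Relation.Unary.AllPairs using ([]; _∷_)
open import Data.List.Relation.Unary.Any using (here; there)
open import Data.List.Relation.Unary.Linked as Linked using (Linked; []; [-]; _∷_)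
import Data.List.Relation.Unary.Linked.Properties as Linked
open import Data.List.Relation.Unary.Unique.Propositional using (Unique)
import Data.List.Relation.Unary.Unique.Propositional.Properties as Unique
open import Data.Nat.Base as ℕ using (ℕ; zero; suc; NonZero; NonTrivial)
open import Data.Nat.ListAction using (product)
open import Data.Nat.ListAction.Properties using (product≢0)
import Data.Nat.Properties as ℕP
open import Data.Nat.Properties using (m^n≢0)
open import Data.Product.Base using (Σ; ∃; _×_; _,_; proj₁; proj₂)
open import Data.Rational.Base as ℚ
  using (ℚ; 0ℚ; 1ℚ; ½; _+_; _-_; -_; _≤_; _<_; ∣_∣; _/_) renaming (_*_ to _·_)
import Data.Rational.Properties as ℚP
open import Data.Rational.Solver using () renaming (module +-*-Solver to ℚ-Solver)
open import Data.Rational.Unnormalised.Base as ℚᵘ using (mkℚᵘ; *≡*)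
import Data.Rational.Unnormalised.Properties as ℚᵘP
open import Data.Sum.Base using (inj₁; inj₂)
open import Function.Base using (_∘_; _$_)
open import Relation.Binary.PropositionalEquality
open import Relation.Nullary.Decidable using (from-yes)
open import Defs
open ℚ-Solver using (solve; con; _:=_; _:+_; _:*_; _:-_; :-_)
open ℝ-lemmas using (/-mono; toℚᵘ-/; /-+; archimedean; bound; divide; ∣ab-cd∣≤; ½+½; 0<½*; ∣-∣-swap; *-mono-≤)
open ζ-lemmas using (ζ-tail; ζ-Cauchy)
open π-lemmas using (alt; /-alt; alternating)

-- Limits are never formed: each asymptotic statement is a relation `≈` between rational sequences
-- whose difference tends to 0, and powers of π enter through the approximants `π²ₙ`. The
-- alternating sum is compared with ζ at even truncations, where its terms pair up exactly; this is
-- why the limits of `h` are taken along 2N. Newton's identity contains the unknown power sum twice,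
-- once inside h k = c ζ(2k) and once as the summand p k · h 0, so it determines ζ(2k) only when kc
-- ≠ 1. For k = 1 the constant c is 1 and the identity is empty, hence the separate treatment of ζ
-- 2. There the definition of π as a Leibniz series dictates the route: the series converges only
-- conditionally, so its square is not expanded as an infinite double sum, and the cross terms are
-- controlled at each finite N.

ι : ℕ → ℚ
ι n = + n / 1

-- The shift makes `inv` total, and sums starting at index 0 then run over the positive integers.
inv : ℕ → ℚ
inv n = + 1 / suc n

recip-· : ∀ a b .{{_ : NonZero a}} .{{_ : NonZero b}} .{{_ : NonZero (a ℕ.* b)}} →
  + 1 / (a ℕ.* b) ≡ (+ 1 / a) · (+ 1 / b)
recip-· (suc a) (suc b) = ℚP.toℚᵘ-injective (begin
  ℚ.toℚᵘ (+ 1 / (suc a ℕ.* suc b))                   ≈⟨ toℚᵘ-/ (+ 1) (b ℕ.+ a ℕ.* suc b) ⟩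
  mkℚᵘ (+ 1) (b ℕ.+ a ℕ.* suc b)                     ≈⟨ ℚᵘP.*-cong (toℚᵘ-/ (+ 1) a) (toℚᵘ-/ (+ 1) b) ⟨
  ℚ.toℚᵘ (+ 1 / suc a) ℚᵘ.* ℚ.toℚᵘ (+ 1 / suc b)     ≈⟨ ℚP.toℚᵘ-homo-* (+ 1 / suc a) (+ 1 / suc b) ⟨
  ℚ.toℚᵘ ((+ 1 / suc a) · (+ 1 / suc b))             ∎)
  where
  open import Relation.Binary.Reasoning.Setoid ℚᵘP.≃-setoid

/≡ι· : ∀ a b → + a / suc b ≡ ι a · inv b
/≡ι· a b = ℚP.toℚᵘ-injective (begin
  ℚ.toℚᵘ (+ a / suc b)                ≈⟨ toℚᵘ-/ (+ a) b ⟩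
  mkℚᵘ (+ a) b                        ≈⟨ *≡* (cong₂ (λ x y → x ℤ.* + y) (sym (ℤP.*-identityʳ (+ a))) (ℕP.*-identityˡ (suc b))) ⟩
  mkℚᵘ (+ a) 0 ℚᵘ.* mkℚᵘ (+ 1) b      ≈⟨ ℚᵘP.*-cong (toℚᵘ-/ (+ a) 0) (toℚᵘ-/ (+ 1) b) ⟨
  ℚ.toℚᵘ (ι a) ℚᵘ.* ℚ.toℚᵘ (inv b)    ≈⟨ ℚP.toℚᵘ-homo-* (ι a) (inv b) ⟨
  ℚ.toℚᵘ (ι a · inv b)                ∎)
  where
  open import Relation.Binary.Reasoning.Setoid ℚᵘP.≃-setoid

n/n≡1 : ∀ n → + suc n / suc n ≡ 1ℚ
n/n≡1 n = ℚP.toℚᵘ-injective (ℚᵘP.≃-trans (toℚᵘ-/ (+ suc n) n) (*≡* (ℤP.*-comm (+ suc n) (+ 1))))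

ι·inv : ∀ n → ι (suc n) · inv n ≡ 1ℚ
ι·inv n = trans (sym (/≡ι· (suc n) n)) (n/n≡1 n)

ι-+ : ∀ m n → ι (m ℕ.+ n) ≡ ι m + ι n
ι-+ m n = sym (trans (/-+ m 0 n 0) (cong ι (cong₂ ℕ._+_ (ℕP.*-identityʳ m) (ℕP.*-identityʳ n))))

ι-suc : ∀ n → ι (suc n) ≡ 1ℚ + ι n
ι-suc n = ι-+ 1 n

ι-mono : ∀ {m n} → m ℕ.≤ n → ι m ≤ ι n
ι-mono {m} {n} m≤n = /-mono m 0 n 0 (ℕP.*-monoˡ-≤ 1 m≤n)

inv-anti : ∀ {m n} → m ℕ.≤ n → inv n ≤ inv m
inv-anti {m} {n} m≤n = /-mono 1 n 1 m (ℕP.*-monoʳ-≤ 1 (ℕ.s≤s m≤n))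

0≤ι : ∀ n → 0ℚ ≤ ι n
0≤ι n = ι-mono {0} {n} ℕ.z≤n

0≤inv : ∀ n → 0ℚ ≤ inv n
0≤inv n = /-mono 0 0 1 n ℕ.z≤n

inv≤1 : ∀ n → inv n ≤ 1ℚ
inv≤1 n = inv-anti {0} {n} ℕ.z≤n

-- Powers and signs

infixr 8 _↑_

_↑_ : ℚ → ℕ → ℚ
q ↑ zero  = 1ℚ
q ↑ suc n = q · q ↑ n

↑-+ : ∀ q m n → q ↑ (m ℕ.+ n) ≡ q ↑ m · q ↑ n
↑-+ q zero    n = sym (ℚP.*-identityˡ (q ↑ n))
↑-+ q (suc m) n = trans (cong (q ·_) (↑-+ q m n)) (sym (ℚP.*-assoc q (q ↑ m) (q ↑ n)))

↑-double : ∀ q n → q ↑ (2 ℕ.* n) ≡ (q · q) ↑ n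
↑-double q n = trans (cong (q ↑_) (cong (n ℕ.+_) (ℕP.+-identityʳ n))) (go n)
  where
  go : ∀ n → q ↑ (n ℕ.+ n) ≡ (q · q) ↑ n
  go zero    = refl
  go (suc n) = trans (cong (q ·_) (trans (cong (q ↑_) (ℕP.+-suc n n)) (cong (q ·_) (go n)))) (sym (ℚP.*-assoc q q _))

·-↑ : ∀ p q n → (p · q) ↑ n ≡ p ↑ n · q ↑ n
·-↑ p q zero    = refl
·-↑ p q (suc n) = trans (cong (p · q ·_) (·-↑ p q n))
  (solve 4 (λ p q a b → p :* q :* (a :* b) := p :* a :* (q :* b)) refl p q (p ↑ n) (q ↑ n))

0≤· : ∀ {p q} → 0ℚ ≤ p → 0ℚ ≤ q → 0ℚ ≤ p · q
0≤· {p} {q} 0≤p 0≤q = subst (_≤ p · q) (ℚP.*-zeroˡ q) (*-mono-≤ 0ℚ p q q 0≤q 0≤p 0≤p ℚP.≤-refl)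

0≤↑ : ∀ {q} n → 0ℚ ≤ q → 0ℚ ≤ q ↑ n
0≤↑ zero    0≤q = ℚP.nonNegative⁻¹ 1ℚ
0≤↑ (suc n) 0≤q = 0≤· 0≤q (0≤↑ n 0≤q)

↑≤1 : ∀ {q} n → 0ℚ ≤ q → q ≤ 1ℚ → q ↑ n ≤ 1ℚ
↑≤1 zero    0≤q q≤1 = ℚP.≤-refl
↑≤1 {q} (suc n) 0≤q q≤1 = *-mono-≤ q 1ℚ (q ↑ n) 1ℚ (0≤↑ n 0≤q) (ℚP.nonNegative⁻¹ 1ℚ) q≤1 (↑≤1 n 0≤q q≤1)

1/^≡inv↑ : ∀ n s → 1/ suc n ^ s ≡ inv n ↑ s
1/^≡inv↑ n zero    = refl
1/^≡inv↑ n (suc s) = trans (recip-· (suc n) (suc n ℕ.^ s) {{_}} {{m^n≢0 (suc n) s}} {{m^n≢0 (suc n) (suc s)}})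
  (cong (inv n ·_) (1/^≡inv↑ n s))

sgn : ℕ → ℚ
sgn zero    = 1ℚ
sgn (suc n) = - sgn n

sgn·sgn : ∀ n → sgn n · sgn n ≡ 1ℚ
sgn·sgn zero    = refl
sgn·sgn (suc n) = trans (solve 1 (λ a → (:- a) :* (:- a) := a :* a) refl (sgn n)) (sgn·sgn n)

sgn-+ : ∀ m n → sgn (m ℕ.+ n) ≡ sgn m · sgn n
sgn-+ zero    n = sym (ℚP.*-identityˡ (sgn n))
sgn-+ (suc m) n = trans (cong -_ (sgn-+ m n)) (ℚP.neg-distribˡ-* (sgn m) (sgn n))

∣sgn·∣ : ∀ n q → ∣ sgn n · q ∣ ≡ ∣ q ∣
∣sgn·∣ zero    q = cong ∣_∣ (ℚP.*-identityˡ q)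
∣sgn·∣ (suc n) q = trans (cong ∣_∣ (sym (ℚP.neg-distribˡ-* (sgn n) q))) (trans (ℚP.∣-p∣≡∣p∣ (sgn n · q)) (∣sgn·∣ n q))

-- Finite sums

∑ : (ℕ → ℚ) → ℕ → ℚ
∑ f zero    = 0ℚ
-- The new term comes last, unlike in `partialSum`, to suit the inductions from N to N + 1.
∑ f (suc n) = ∑ f n + f n

∑-cong< : ∀ {f g} n → (∀ i → i ℕ.< n → f i ≡ g i) → ∑ f n ≡ ∑ g n
∑-cong< zero    h = refl
∑-cong< (suc n) h = cong₂ _+_ (∑-cong< n λ i i<n → h i (ℕP.m<n⇒m<1+n i<n)) (h n (ℕP.n<1+n n))

∑-cong : ∀ {f g} n → (∀ i → f i ≡ g i) → ∑ f n ≡ ∑ g n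
∑-cong n h = ∑-cong< n λ i _ → h i

∑-front : ∀ f n → ∑ f (suc n) ≡ f 0 + ∑ (f ∘ suc) n
∑-front f zero    = trans (ℚP.+-identityˡ (f 0)) (sym (ℚP.+-identityʳ (f 0)))
∑-front f (suc n) = trans (cong (_+ f (suc n)) (∑-front f n)) (ℚP.+-assoc (f 0) _ _)

partialSum≡∑ : ∀ f n → partialSum f n ≡ ∑ f n
partialSum≡∑ f zero    = refl
partialSum≡∑ f (suc n) = trans (cong (_+_ (f 0)) (partialSum≡∑ (f ∘ suc) n)) (sym (∑-front f n))

∑-reverse : ∀ f n → ∑ (λ i → f (n ℕ.∸ suc i)) n ≡ ∑ f n
∑-reverse f zero    = refl
∑-reverse f (suc n) = trans (∑-front (λ i → f (n ℕ.∸ i)) n)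
  (trans (cong (_+_ (f n)) (∑-reverse f n)) (ℚP.+-comm (f n) (∑ f n)))

∑-split : ∀ f m n → ∑ f (m ℕ.+ n) ≡ ∑ f m + ∑ (λ i → f (m ℕ.+ i)) n
∑-split f m zero    = trans (cong (∑ f) (ℕP.+-identityʳ m)) (sym (ℚP.+-identityʳ (∑ f m)))
∑-split f m (suc n) = trans (cong (∑ f) (ℕP.+-suc m n))
  (trans (cong (_+ f (m ℕ.+ n)) (∑-split f m n)) (ℚP.+-assoc (∑ f m) _ _))

∑-pairs : ∀ f n → ∑ f (n ℕ.* 2) ≡ ∑ (λ i → f (i ℕ.* 2) + f (suc (i ℕ.* 2))) n
∑-pairs f zero    = refl
∑-pairs f (suc n) = trans (ℚP.+-assoc (∑ f (n ℕ.* 2)) _ _) (cong (_+ (f (n ℕ.* 2) + f (suc (n ℕ.* 2)))) (∑-pairs f n))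

∑-+ : ∀ f g n → ∑ (λ i → f i + g i) n ≡ ∑ f n + ∑ g n
∑-+ f g zero    = refl
∑-+ f g (suc n) = trans (cong (_+ (f n + g n)) (∑-+ f g n))
  (solve 4 (λ a b c d → a :+ b :+ (c :+ d) := a :+ c :+ (b :+ d)) refl (∑ f n) (∑ g n) (f n) (g n))

∑-· : ∀ c f n → ∑ (λ i → c · f i) n ≡ c · ∑ f n
∑-· c f zero    = sym (ℚP.*-zeroʳ c)
∑-· c f (suc n) = trans (cong (_+ c · f n) (∑-· c f n)) (sym (ℚP.*-distribˡ-+ c (∑ f n) (f n)))

∑-mono< : ∀ {f g} n → (∀ i → i ℕ.< n → f i ≤ g i) → ∑ f n ≤ ∑ g n
∑-mono< zero    h = ℚP.≤-refl
∑-mono< (suc n) h = ℚP.+-mono-≤ (∑-mono< n λ i i<n → h i (ℕP.m<n⇒m<1+n i<n)) (h n (ℕP.n<1+n n))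

∣∑∣≤ : ∀ f n → ∣ ∑ f n ∣ ≤ ∑ (λ i → ∣ f i ∣) n
∣∑∣≤ f zero    = ℚP.≤-refl
∣∑∣≤ f (suc n) = ℚP.≤-trans (ℚP.∣p+q∣≤∣p∣+∣q∣ (∑ f n) (f n)) (ℚP.+-monoˡ-≤ ∣ f n ∣ (∣∑∣≤ f n))

∑-const : ∀ c n → ∑ (λ _ → c) n ≡ ι n · c
∑-const c zero    = sym (ℚP.*-zeroˡ c)
∑-const c (suc n) = trans (cong (_+ c) (∑-const c n))
  (trans (solve 2 (λ c n → n :* c :+ c := (con 1ℚ :+ n) :* c) refl c (ι n)) (cong (_· c) (sym (ι-suc n))))

p≤q⇒0≤q-p : ∀ {p q} → p ≤ q → 0ℚ ≤ q - p
p≤q⇒0≤q-p {p} {q} p≤q = subst (_≤ q - p) (ℚP.+-inverseʳ p) (ℚP.+-monoˡ-≤ (- p) p≤q)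

p≤∣p∣ : ∀ p → p ≤ ∣ p ∣
p≤∣p∣ p with ℚP.≤-total 0ℚ p
... | inj₁ 0≤p = ℚP.≤-reflexive (sym (ℚP.0≤p⇒∣p∣≡p 0≤p))
... | inj₂ p≤0 = ℚP.≤-trans p≤0 (ℚP.0≤∣p∣ p)

-p≤∣p∣ : ∀ p → - p ≤ ∣ p ∣
-p≤∣p∣ p = subst (- p ≤_) (ℚP.∣-p∣≡∣p∣ p) (p≤∣p∣ (- p))

∣∣≤ : ∀ {p q} → p ≤ q → - p ≤ q → ∣ p ∣ ≤ q
∣∣≤ {p} {q} p≤q -p≤q with ℚP.∣p∣≡p∨∣p∣≡-p p
... | inj₁ eq = subst (_≤ q) (sym eq) p≤q
... | inj₂ eq = subst (_≤ q) (sym eq) -p≤q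

between : ∀ {a b t x ε} → a ≤ t → t ≤ b → ∣ a - x ∣ ≤ ε → ∣ b - x ∣ ≤ ε → ∣ t - x ∣ ≤ ε
between {a} {b} {t} {x} a≤t t≤b ha hb = ∣∣≤
  (ℚP.≤-trans (ℚP.+-monoˡ-≤ (- x) t≤b) (ℚP.≤-trans (p≤∣p∣ (b - x)) hb))
  (ℚP.≤-trans (ℚP.neg-antimono-≤ (ℚP.+-monoˡ-≤ (- x) a≤t)) (ℚP.≤-trans (-p≤∣p∣ (a - x)) ha))

-- Limits of rational sequences

infix 4 _≈_

-- A record rather than a function, so that f and g can be inferred from a proof.
record _≈_ (f g : ℕ → ℚ) : Set where
  field
    close : ∀ ε → 0ℚ < ε → ∃ λ N → ∀ n → N ℕ.≤ n → ∣ f n - g n ∣ ≤ ε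

open _≈_

∣p-p∣ : ∀ p → ∣ p - p ∣ ≡ 0ℚ
∣p-p∣ p = cong ∣_∣ (ℚP.+-inverseʳ p)

≈-reflexive : ∀ {f g} → (∀ n → f n ≡ g n) → f ≈ g
≈-reflexive {f} {g} h .close ε 0<ε = 0 , λ n _ →
  subst (_≤ ε) (sym (trans (cong (λ p → ∣ p - g n ∣) (h n)) (∣p-p∣ (g n)))) (ℚP.<⇒≤ 0<ε)

≈-sym : ∀ {f g} → f ≈ g → g ≈ f
≈-sym {f} {g} h .close ε 0<ε = let (N , h′) = h .close ε 0<ε in N , λ n N≤n →
  subst (_≤ ε) (∣-∣-swap (f n) (g n)) (h′ n N≤n)

module _ {a b : ℕ → Set} where

  eventually-× : (∃ λ N → ∀ n → N ℕ.≤ n → a n) → (∃ λ N → ∀ n → N ℕ.≤ n → b n) →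
    ∃ λ N → ∀ n → N ℕ.≤ n → a n × b n
  eventually-× (M , h) (N , k) = M ℕ.⊔ N , λ n ≤n →
    h n (ℕP.m⊔n≤o⇒m≤o M N ≤n) , k n (ℕP.m⊔n≤o⇒n≤o M N ≤n)

≈-combine : ∀ {f g h k u v : ℕ → ℚ} → (∀ n → ∣ u n - v n ∣ ≤ ∣ f n - g n ∣ + ∣ h n - k n ∣) →
  f ≈ g → h ≈ k → u ≈ v
≈-combine {f} {g} {h} {k} {u} {v} le f≈g h≈k .close ε 0<ε =
  let (N , H) = eventually-× (f≈g .close (½ · ε) (0<½* 0<ε)) (h≈k .close (½ · ε) (0<½* 0<ε))
  in N , λ n N≤n → ℚP.≤-trans (le n)
    (subst (∣ f n - g n ∣ + ∣ h n - k n ∣ ≤_) (½+½ ε) (ℚP.+-mono-≤ (proj₁ (H n N≤n)) (proj₂ (H n N≤n))))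

≈-trans : ∀ {f g h} → f ≈ g → g ≈ h → f ≈ h
≈-trans {f} {g} {h} = ≈-combine λ n → subst (λ p → ∣ p ∣ ≤ ∣ f n - g n ∣ + ∣ g n - h n ∣)
  (solve 3 (λ a b c → (a :- b) :+ (b :- c) := a :- c) refl (f n) (g n) (h n))
  (ℚP.∣p+q∣≤∣p∣+∣q∣ (f n - g n) (g n - h n))

+-cong : ∀ {f g h k} → f ≈ g → h ≈ k → (λ n → f n + h n) ≈ (λ n → g n + k n)
+-cong {f} {g} {h} {k} = ≈-combine λ n → subst (λ p → ∣ p ∣ ≤ ∣ f n - g n ∣ + ∣ h n - k n ∣)
  (solve 4 (λ a b c d → (a :- b) :+ (c :- d) := (a :+ c) :- (b :+ d)) refl (f n) (g n) (h n) (k n))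
  (ℚP.∣p+q∣≤∣p∣+∣q∣ (f n - g n) (h n - k n))

-- Bounded only from some index on, which is what `bound` yields for a Cauchy sequence.
Bounded : (ℕ → ℚ) → Set
Bounded f = ∃ λ N → ∃ λ B → 0ℚ < B × (∀ n → N ℕ.≤ n → ∣ f n ∣ ≤ B)

const-bounded : ∀ c → Bounded (λ _ → c)
const-bounded c = 0 , ∣ c ∣ + 1ℚ , ℚP.+-mono-≤-< (ℚP.0≤∣p∣ c) (ℚP.positive⁻¹ 1ℚ) ,
  λ _ _ → subst (_≤ ∣ c ∣ + 1ℚ) (ℚP.+-identityʳ ∣ c ∣) (ℚP.+-monoʳ-≤ ∣ c ∣ (ℚP.nonNegative⁻¹ 1ℚ))

≈-bounded : ∀ {f g} → f ≈ g → Bounded g → Bounded f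
≈-bounded {f} {g} f≈g (N , B , 0<B , g≤B) =
  let (N′ , H) = eventually-× (f≈g .close 1ℚ (ℚP.positive⁻¹ 1ℚ)) (N , g≤B)
  in N′ , 1ℚ + B , ℚP.+-mono-< (ℚP.positive⁻¹ 1ℚ) 0<B , λ n ≤n →
    subst (λ p → ∣ p ∣ ≤ 1ℚ + B) (solve 2 (λ a b → (a :- b) :+ b := a) refl (f n) (g n))
      (ℚP.≤-trans (ℚP.∣p+q∣≤∣p∣+∣q∣ (f n - g n) (g n)) (ℚP.+-mono-≤ (proj₁ (H n ≤n)) (proj₂ (H n ≤n))))

·-cong : ∀ {f g h k} → Bounded g → Bounded k → f ≈ g → h ≈ k → (λ n → f n · h n) ≈ (λ n → g n · k n)
·-cong {f} {g} {h} {k} bg (N , C , 0<C , k≤C) f≈g h≈k .close ε 0<ε =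
  let (M , B , 0<B , f≤B) = ≈-bounded f≈g bg
      (δ , 0<δ , Kδ≡ε)    = divide (B + C) ε (ℚP.+-mono-< 0<B 0<C) 0<ε
      (P , H)             = eventually-× (eventually-× (M , f≤B) (N , k≤C)) (eventually-× (h≈k .close δ 0<δ) (f≈g .close δ 0<δ))
  in P , λ n P≤n → let ((f≤ , k≤) , (hk , fg)) = H n P≤n in
    subst (∣ f n · h n - g n · k n ∣ ≤_) Kδ≡ε
      (∣ab-cd∣≤ (f n) (h n) (g n) (k n) B C δ (ℚP.<⇒≤ 0<B) (ℚP.<⇒≤ 0<C) f≤ k≤ hk fg)

scale : ∀ c {f g} → f ≈ g → (λ n → c · f n) ≈ (λ n → c · g n)
scale c {f} {g} f≈g .close ε 0<ε =
  let (_ , B , 0<B , c≤B) = const-bounded c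
      (δ , 0<δ , Bδ≡ε)    = divide B ε 0<B 0<ε
      (N , H)             = f≈g .close δ 0<δ
  in N , λ n N≤n → subst₂ _≤_
    (trans (sym (ℚP.∣p*q∣≡∣p∣*∣q∣ c (f n - g n)))
      (cong ∣_∣ (solve 3 (λ c a b → c :* (a :- b) := c :* a :- c :* b) refl c (f n) (g n)))) Bδ≡ε
    (*-mono-≤ (∣ c ∣) B (∣ f n - g n ∣) δ (ℚP.0≤∣p∣ (f n - g n)) (ℚP.<⇒≤ 0<B) (c≤B 0 ℕ.z≤n) (H n N≤n))

scale-cancel : ∀ c {f g} → .{{ℚ.NonZero c}} → (λ n → c · f n) ≈ (λ n → c · g n) → f ≈ g
scale-cancel c {f} {g} h = ≈-trans (≈-reflexive λ n → undo (f n))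
  (≈-trans (scale (ℚ.1/ c) h) (≈-reflexive λ n → sym (undo (g n))))
  where
  undo : ∀ q → q ≡ ℚ.1/ c · (c · q)
  undo q = trans (sym (ℚP.*-identityˡ q)) (trans (cong (_· q) (sym (ℚP.*-inverseˡ c))) (ℚP.*-assoc (ℚ.1/ c) c q))

Cauchy-reindex : ∀ {f} (φ : ℕ → ℕ) → (∀ n → n ℕ.≤ φ n) → Cauchy f → f ∘ φ ≈ f
Cauchy-reindex φ n≤φ c .close ε 0<ε = let (N , h) = c ε 0<ε in
  N , λ n N≤n → h (φ n) n (ℕP.≤-trans N≤n (n≤φ n)) N≤n

inv-null : ∀ C ε → 0ℚ < ε → ∃ λ N → ∀ n → N ℕ.≤ n → ι C · inv n ≤ ε
inv-null C ε 0<ε =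
  -- Dividing by C + 1 keeps the divisor positive when C = 0.
  let (δ , 0<δ , Cδ≡ε) = divide (ι (suc C)) ε (0<ι C) 0<ε
      (N , 4/N≤δ)      = archimedean δ 0<δ
  in N , λ n N≤n → subst (ι C · inv n ≤_) Cδ≡ε
    (*-mono-≤ (ι C) (ι (suc C)) (inv n) δ (0≤inv n) (0≤ι (suc C)) (ι-mono (ℕP.n≤1+n C))
      (ℚP.≤-trans (inv-anti N≤n) (ℚP.≤-trans (/-mono 1 N 4 N (ℕP.*-monoˡ-≤ (suc N) (ℕ.s≤s (ℕ.z≤n {3})))) 4/N≤δ)))
  where
  0<ι : ∀ n → 0ℚ < ι (suc n)
  0<ι n = ℚP.<-≤-trans (ℚP.positive⁻¹ 1ℚ) (ι-mono {1} {suc n} (ℕ.s≤s ℕ.z≤n))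

-- Dominated convergence arguments produce bounds of this shape: M is the cut-off below which the
-- terms are small and above which the tail is.
squeeze : ∀ K {f g} → (∀ M n → ∣ f n - g n ∣ ≤ ι K · (ι M · inv n + inv M)) → f ≈ g
squeeze K {f} {g} h .close ε 0<ε =
  -- M is fixed first; N may then depend on it.
  let (M , hM) = inv-null K (½ · ε) (0<½* 0<ε)
      (N , hN) = inv-null (K ℕ.* M) (½ · ε) (0<½* 0<ε)
  in N , λ n N≤n → ℚP.≤-trans (h M n) (subst₂ _≤_
       (trans (cong (λ q → q · inv n + ι K · inv M) (ι-* K M))
         (solve 4 (λ k m a b → k :* m :* a :+ k :* b := k :* (m :* a :+ b)) refl (ι K) (ι M) (inv n) (inv M)))
       (½+½ ε) (ℚP.+-mono-≤ (hN n N≤n) (hM M ℕP.≤-refl)))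
  where
  ι-* : ∀ m n → ι (m ℕ.* n) ≡ ι m · ι n
  ι-* zero    n = sym (ℚP.*-zeroˡ (ι n))
  ι-* (suc m) n = trans (ι-+ n (m ℕ.* n)) (trans (cong (_+_ (ι n)) (ι-* m n))
    (trans (solve 2 (λ a b → b :+ a :* b := (con 1ℚ :+ a) :* b) refl (ι m) (ι n)) (cong (_· ι n) (sym (ι-suc m)))))

∑-tail : ∀ M d → ∑ (λ i → inv (M ℕ.+ i) · inv (M ℕ.+ i)) d ≤ ι 2 · inv M
∑-tail M d = subst₂ _≤_ (partialSum≡∑ _ d) (/≡ι· 2 M)
  (ζ-tail (λ i → inv (M ℕ.+ i) · inv (M ℕ.+ i)) M
    (λ i → ℚP.≤-reflexive (trans (cong (λ k → inv k · inv k) (ℕP.+-comm M i)) (sym (recip-· (suc (i ℕ.+ M)) (suc (i ℕ.+ M)))))) d)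

-- The first M terms cost at most δ each; the later ones are dominated by a tail of Σ 1/n².
∑-dominated : ∀ t δ N → 0ℚ ≤ δ → (∀ i → i ℕ.< N → t i ≤ δ) → (∀ i → i ℕ.< N → t i ≤ inv i · inv i) →
  ∀ M → ∑ t N ≤ ι M · δ + ι 2 · inv M
∑-dominated t δ N 0≤δ t≤δ t≤inv² M with ℕP.≤-total N M
... | inj₁ N≤M = begin
  ∑ t N                     ≤⟨ ∑-mono< N t≤δ ⟩
  ∑ (λ _ → δ) N             ≡⟨ ∑-const δ N ⟩
  ι N · δ                   ≤⟨ *-mono-≤ (ι N) (ι M) δ δ 0≤δ (0≤ι M) (ι-mono N≤M) ℚP.≤-refl ⟩
  ι M · δ                   ≡⟨ ℚP.+-identityʳ (ι M · δ) ⟨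
  ι M · δ + 0ℚ              ≤⟨ ℚP.+-monoʳ-≤ (ι M · δ) (0≤· (0≤ι 2) (0≤inv M)) ⟩
  ι M · δ + ι 2 · inv M     ∎
  where open ℚP.≤-Reasoning
... | inj₂ M≤N with ℕP.m≤n⇒∃[o]m+o≡n M≤N
... | d , refl = begin
  ∑ t (M ℕ.+ d)                                   ≡⟨ ∑-split t M d ⟩
  ∑ t M + ∑ (λ i → t (M ℕ.+ i)) d                 ≤⟨ ℚP.+-mono-≤ (∑-mono< M λ i i<M → t≤δ i (ℕP.<-≤-trans i<M M≤N))
                                                       (∑-mono< d λ i i<d → t≤inv² (M ℕ.+ i) (ℕP.+-monoʳ-< M i<d)) ⟩
  ∑ (λ _ → δ) M + ∑ (λ i → inv (M ℕ.+ i) · inv (M ℕ.+ i)) d  ≤⟨ ℚP.+-mono-≤ (ℚP.≤-reflexive (∑-const δ M)) (∑-tail M d) ⟩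
  ι M · δ + ι 2 · inv M                           ∎
  where open ℚP.≤-Reasoning

≈-reindex : ∀ {f g} (φ : ℕ → ℕ) → (∀ n → n ℕ.≤ φ n) → f ≈ g → f ∘ φ ≈ g ∘ φ
≈-reindex φ n≤φ f≈g .close ε 0<ε = let (N , h) = f≈g .close ε 0<ε in
  N , λ n N≤n → h (φ n) (ℕP.≤-trans N≤n (n≤φ n))

-- Symmetric polynomials and partial fractions

inv² : ℕ → ℚ
inv² n = inv n · inv n

ι²·inv² : ∀ n → ι (suc n) · ι (suc n) · inv² n ≡ 1ℚ
ι²·inv² n = trans (solve 2 (λ a b → a :* a :* (b :* b) := (a :* b) :* (a :* b)) refl (ι (suc n)) (inv n))
  (cong₂ _·_ (ι·inv n) (ι·inv n))

0≤inv² : ∀ n → 0ℚ ≤ inv² n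
0≤inv² n = 0≤· (0≤inv n) (0≤inv n)

inv²≤1 : ∀ n → inv² n ≤ 1ℚ
inv²≤1 n = *-mono-≤ (inv n) 1ℚ (inv n) 1ℚ (0≤inv n) (ℚP.nonNegative⁻¹ 1ℚ) (inv≤1 n) (inv≤1 n)

-- p and h are the power sums and the complete homogeneous symmetric polynomials at 1, 1/2², …, 1/N².

p : ℕ → ℕ → ℚ
p k = ∑ (λ i → inv² i ↑ k)

h : ℕ → ℕ → ℚ
h zero    N       = 1ℚ
h (suc k) zero    = 0ℚ
h (suc k) (suc N) = h (suc k) N + inv² N · h k (suc N)

-- w N m = (N!)² / ((N - m)! (N + m)!), which is 0 for m > N.
w : ℕ → ℕ → ℚ
w N zero    = 1ℚ
w N (suc m) = w N m · ((ι N - ι m) · inv (N ℕ.+ m))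

[1+N+m]·inv : ∀ N m → (1ℚ + ι N + ι m) · inv (N ℕ.+ m) ≡ 1ℚ
[1+N+m]·inv N m = trans (cong (_· inv (N ℕ.+ m))
  (trans (ℚP.+-assoc 1ℚ (ι N) (ι m)) (trans (cong (_+_ 1ℚ) (sym (ι-+ N m))) (sym (ι-suc (N ℕ.+ m)))))) (ι·inv (N ℕ.+ m))

w-step : ∀ N m → w N (suc m) · (1ℚ + ι N + ι m) ≡ w N m · (ι N - ι m)
w-step N m = trans
  (solve 4 (λ w d b s → w :* (d :* b) :* s := w :* d :* (s :* b)) refl (w N m) (ι N - ι m) (inv (N ℕ.+ m)) (1ℚ + ι N + ι m))
  (trans (cong (w N m · (ι N - ι m) ·_) ([1+N+m]·inv N m)) (ℚP.*-identityʳ _))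

-- The closed form gives w (N + 1) m / w N m = (N + 1)² / ((N + 1)² - m²). Cleared of denominators
-- it also covers m = N + 1, where both sides vanish; `F-step` sums that far.
w-ratio : ∀ N m → w (suc N) m · (ι (suc N) · ι (suc N) - ι m · ι m) ≡ w N m · (ι (suc N) · ι (suc N))
w-ratio N zero    = cong (1ℚ ·_) (ℚP.+-identityʳ (ι (suc N) · ι (suc N)))
w-ratio N (suc m) = begin
  W′ · ((n - ι m) · b) · (n · n - ι (suc m) · ι (suc m))                  ≡⟨ cong₂ (λ n M → W′ · ((n - ι m) · b) · (n · n - M · M)) (ι-suc N) (ι-suc m) ⟩
  W′ · ((1ℚ + ι N - ι m) · b) · ((1ℚ + ι N) · (1ℚ + ι N) - (1ℚ + ι m) · (1ℚ + ι m))
    ≡⟨ solve 4 (λ w n m b → let n⁺ = con 1ℚ :+ n; m⁺ = con 1ℚ :+ m in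
         w :* ((n⁺ :- m) :* b) :* (n⁺ :* n⁺ :- m⁺ :* m⁺) := w :* ((n⁺ :- m) :* (n :- m)) :* ((con 1ℚ :+ n⁺ :+ m) :* b))
         refl W′ (ι N) (ι m) b ⟩
  W′ · ((1ℚ + ι N - ι m) · (ι N - ι m)) · ((1ℚ + (1ℚ + ι N) + ι m) · b)
    ≡⟨ cong (W′ · ((1ℚ + ι N - ι m) · (ι N - ι m)) ·_) (trans (cong (λ k → (1ℚ + k + ι m) · b) (sym (ι-suc N))) ([1+N+m]·inv (suc N) m)) ⟩
  W′ · ((1ℚ + ι N - ι m) · (ι N - ι m)) · 1ℚ
    ≡⟨ cong (W′ · ((1ℚ + ι N - ι m) · (ι N - ι m)) ·_) ([1+N+m]·inv N m) ⟨
  W′ · ((1ℚ + ι N - ι m) · (ι N - ι m)) · ((1ℚ + ι N + ι m) · c)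
    ≡⟨ solve 4 (λ w n m c → let n⁺ = con 1ℚ :+ n in
         w :* ((n⁺ :- m) :* (n :- m)) :* ((n⁺ :+ m) :* c) := w :* (n⁺ :* n⁺ :- m :* m) :* ((n :- m) :* c))
         refl W′ (ι N) (ι m) c ⟩
  W′ · ((1ℚ + ι N) · (1ℚ + ι N) - ι m · ι m) · ((ι N - ι m) · c)  ≡⟨ cong (λ n → W′ · (n · n - ι m · ι m) · ((ι N - ι m) · c)) (ι-suc N) ⟨
  W′ · (n · n - ι m · ι m) · ((ι N - ι m) · c)                    ≡⟨ cong (_· ((ι N - ι m) · c)) (w-ratio N m) ⟩
  w N m · (n · n) · ((ι N - ι m) · c)                              ≡⟨ solve 3 (λ w n d → w :* n :* d := w :* d :* n) refl (w N m) (n · n) ((ι N - ι m) · c) ⟩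
  w N m · ((ι N - ι m) · c) · (n · n)                              ∎
  where
  open ≡-Reasoning
  W′ = w (suc N) m
  n = ι (suc N)
  b = inv (suc N ℕ.+ m)
  c = inv (N ℕ.+ m)

w-vanishes : ∀ N → w N (suc N) ≡ 0ℚ
w-vanishes N = trans (cong (λ q → w N N · (q · inv (N ℕ.+ N))) (ℚP.+-inverseʳ (ι N)))
  (trans (cong (w N N ·_) (ℚP.*-zeroˡ (inv (N ℕ.+ N)))) (ℚP.*-zeroʳ (w N N)))

-- For n = i + 1 ≤ N, `ι 2 · sgn i · w N n` equals ∏ m² / (m² - n²) over m ≤ N with m ≠ n, the
-- coefficient of 1 / (1 - x²/n²) in the partial fraction expansion.
term : ℕ → ℕ → ℕ → ℚ
term k N i = sgn i · (w N (suc i) · inv² i ↑ k)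

F : ℕ → ℕ → ℚ
F k N = ι 2 · ∑ (term k N) N

-- Dividing `w-ratio` by (N + 1)² m², where m = i + 1, turns it into W′ (x - X) = W x; this is then
-- multiplied by the power of x.
term-step : ∀ k N i → term (suc k) (suc N) i ≡ term (suc k) N i + inv² N · term k (suc N) i
term-step k N i = trans (cong (sgn i ·_) core)
  (solve 6 (λ s a x y X b → s :* (a :* (x :* y) :+ X :* (b :* y)) := s :* (a :* (x :* y)) :+ X :* (s :* (b :* y))) refl
    (sgn i) W x (x ↑ k) X W′)
  where
  open ≡-Reasoning
  W = w N (suc i)
  W′ = w (suc N) (suc i)
  x = inv² i
  X = inv² N
  n = ι (suc N)
  m = ι (suc i)
  core : W′ · (x · x ↑ k) ≡ W · (x · x ↑ k) + X · (W′ · x ↑ k)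
  core = begin
    W′ · (x · x ↑ k)
      -- The factors 1 are inserted in order to become n² X and m² x, which exposes n² - m².
      ≡⟨ solve 4 (λ a x y X → a :* (x :* y) := (a :* x :* con 1ℚ :- a :* X :* con 1ℚ) :* y :+ X :* (a :* y)) refl W′ x (x ↑ k) X ⟩
    (W′ · x · 1ℚ - W′ · X · 1ℚ) · x ↑ k + X · (W′ · x ↑ k)
      ≡⟨ cong₂ (λ u v → (W′ · x · u - W′ · X · v) · x ↑ k + X · (W′ · x ↑ k)) (ι²·inv² N) (ι²·inv² i) ⟨
    (W′ · x · (n · n · X) - W′ · X · (m · m · x)) · x ↑ k + X · (W′ · x ↑ k)
      ≡⟨ cong (λ z → z · x ↑ k + X · (W′ · x ↑ k))
           (solve 5 (λ a x n m X → a :* x :* (n :* n :* X) :- a :* X :* (m :* m :* x) := a :* (n :* n :- m :* m) :* (x :* X)) refl W′ x n m X) ⟩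
    W′ · (n · n - m · m) · (x · X) · x ↑ k + X · (W′ · x ↑ k)
      ≡⟨ cong (λ z → z · (x · X) · x ↑ k + X · (W′ · x ↑ k)) (w-ratio N (suc i)) ⟩
    W · (n · n) · (x · X) · x ↑ k + X · (W′ · x ↑ k)
      ≡⟨ cong (_+ X · (W′ · x ↑ k)) (solve 5 (λ a n x X y → a :* (n :* n) :* (x :* X) :* y := a :* (x :* y) :* (n :* n :* X)) refl W n x X (x ↑ k)) ⟩
    W · (x · x ↑ k) · (n · n · X) + X · (W′ · x ↑ k)
      ≡⟨ cong (λ z → W · (x · x ↑ k) · z + X · (W′ · x ↑ k)) (ι²·inv² N) ⟩
    W · (x · x ↑ k) · 1ℚ + X · (W′ · x ↑ k)
      ≡⟨ cong (_+ X · (W′ · x ↑ k)) (ℚP.*-identityʳ (W · (x · x ↑ k))) ⟩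
    W · (x · x ↑ k) + X · (W′ · x ↑ k) ∎

-- The recurrence that defines `h`. The sum for N + 1 has one more term than the one for N; it
-- contributes nothing to the latter because w N (N + 1) = 0.
F-step : ∀ k N → F (suc k) (suc N) ≡ F (suc k) N + inv² N · F k (suc N)
F-step k N = begin
  ι 2 · ∑ (term (suc k) (suc N)) (suc N)
    ≡⟨ cong (ι 2 ·_) (trans (∑-cong (suc N) (term-step k N)) (∑-+ (term (suc k) N) (λ i → inv² N · term k (suc N) i) (suc N))) ⟩
  ι 2 · (∑ (term (suc k) N) N + term (suc k) N N + ∑ (λ i → inv² N · term k (suc N) i) (suc N))
    ≡⟨ cong₂ (λ u v → ι 2 · (∑ (term (suc k) N) N + u + v)) last≡0 (∑-· (inv² N) (term k (suc N)) (suc N)) ⟩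
  ι 2 · (∑ (term (suc k) N) N + 0ℚ + inv² N · ∑ (term k (suc N)) (suc N))
    ≡⟨ solve 4 (λ t a X b → t :* (a :+ con 0ℚ :+ X :* b) := t :* a :+ X :* (t :* b)) refl
         (ι 2) (∑ (term (suc k) N) N) (inv² N) (∑ (term k (suc N)) (suc N)) ⟩
  F (suc k) N + inv² N · F k (suc N) ∎
  where
  open ≡-Reasoning
  last≡0 : term (suc k) N N ≡ 0ℚ
  last≡0 = trans (cong (λ z → sgn N · (z · inv² N ↑ suc k)) (w-vanishes N))
    (trans (cong (sgn N ·_) (ℚP.*-zeroˡ (inv² N ↑ suc k))) (ℚP.*-zeroʳ (sgn N)))

-- Write 2N = (N + m + 1) + (N - m - 1): by `w-step` the first part turns w N (m + 1) into w N m ·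
-- (N - m), the previous boundary term, and the second part gives the new one.
∑-telescopes : ∀ N m → ι N · (ι 2 · ∑ (term 0 N) m) ≡ ι N - sgn m · (w N m · (ι N - ι m))
∑-telescopes N zero    = solve 1 (λ n → n :* con 0ℚ := n :- con 1ℚ :* (con 1ℚ :* (n :- con 0ℚ))) refl (ι N)
∑-telescopes N (suc m) = begin
  ι N · (ι 2 · (∑ (term 0 N) m + sgn m · (w N (suc m) · 1ℚ)))
    ≡⟨ solve 5 (λ n t S s v → n :* (t :* (S :+ s :* (v :* con 1ℚ))) := n :* (t :* S) :+ n :* (t :* (s :* v))) refl (ι N) (ι 2) (∑ (term 0 N) m) (sgn m) (w N (suc m)) ⟩
  ι N · (ι 2 · ∑ (term 0 N) m) + ι N · (ι 2 · (sgn m · w N (suc m)))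
    ≡⟨ cong (_+ ι N · (ι 2 · (sgn m · w N (suc m)))) (trans (∑-telescopes N m) (cong (λ z → ι N - sgn m · z) (sym (w-step N m)))) ⟩
  ι N - sgn m · (w N (suc m) · (1ℚ + ι N + ι m)) + ι N · (ι 2 · (sgn m · w N (suc m)))
    ≡⟨ solve 4 (λ n s v m → n :- s :* (v :* (con 1ℚ :+ n :+ m)) :+ n :* (con (ι 2) :* (s :* v)) := n :- (:- s) :* (v :* (n :- (con 1ℚ :+ m)))) refl (ι N) (sgn m) (w N (suc m)) (ι m) ⟩
  ι N - (- sgn m) · (w N (suc m) · (ι N - (1ℚ + ι m)))
    ≡⟨ cong (λ z → ι N - (- sgn m) · (w N (suc m) · (ι N - z))) (ι-suc m) ⟨
  ι N - sgn (suc m) · (w N (suc m) · (ι N - ι (suc m))) ∎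
  where open ≡-Reasoning

-- The boundary term of `∑-telescopes` vanishes once the summation index reaches the upper
-- parameter. The successor is essential: the empty sum makes `F 0 0` zero.
F-zero : ∀ N → F 0 (suc N) ≡ 1ℚ
F-zero N = begin
  F 0 (suc N)                             ≡⟨ ℚP.*-identityʳ _ ⟨
  F 0 (suc N) · 1ℚ                        ≡⟨ cong (F 0 (suc N) ·_) (ι·inv N) ⟨
  F 0 (suc N) · (ι (suc N) · inv N)       ≡⟨ solve 3 (λ f a b → f :* (a :* b) := a :* f :* b) refl (F 0 (suc N)) (ι (suc N)) (inv N) ⟩
  ι (suc N) · F 0 (suc N) · inv N         ≡⟨ cong (_· inv N) (∑-telescopes (suc N) (suc N)) ⟩
  (ι (suc N) - sgn (suc N) · (w (suc N) (suc N) · (ι (suc N) - ι (suc N)))) · inv N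
    ≡⟨ solve 4 (λ a s v b → (a :- s :* (v :* (a :- a))) :* b := a :* b) refl (ι (suc N)) (sgn (suc N)) (w (suc N) (suc N)) (inv N) ⟩
  ι (suc N) · inv N                       ≡⟨ ι·inv N ⟩
  1ℚ                                      ∎
  where open ≡-Reasoning

-- The partial fraction expansion of ∏ (1 - x²/n²)⁻¹ over n ≤ N, coefficient by coefficient.
h≡F : ∀ k N → h k (suc N) ≡ F k (suc N)
h≡F zero    N       = sym (F-zero N)
h≡F (suc k) zero    = trans (cong (λ z → 0ℚ + inv² 0 · z) (h≡F k 0)) (sym (F-step k 0))
h≡F (suc k) (suc N) = trans (cong₂ (λ u v → u + inv² (suc N) · v) (h≡F (suc k) N) (h≡F k (suc N))) (sym (F-step k (suc N)))

-- The alternating series for h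

0≤1+q : ∀ {q} → 0ℚ ≤ q → 0ℚ ≤ 1ℚ + q
0≤1+q 0≤q = ℚP.+-mono-≤ (ℚP.nonNegative⁻¹ 1ℚ) 0≤q

module _ (N m : ℕ) (m<N : m ℕ.< N) where

  ratio : ℚ
  ratio = (ι N - ι m) · inv (N ℕ.+ m)

  0≤ratio : 0ℚ ≤ ratio
  0≤ratio = 0≤· (p≤q⇒0≤q-p (ι-mono (ℕP.<⇒≤ m<N))) (0≤inv (N ℕ.+ m))

  1-ratio : 1ℚ - ratio ≡ (1ℚ + ι m + ι m) · inv (N ℕ.+ m)
  1-ratio = trans (cong (_- ratio) (sym ([1+N+m]·inv N m)))
    (solve 3 (λ n m b → (con 1ℚ :+ n :+ m) :* b :- (n :- m) :* b := (con 1ℚ :+ m :+ m) :* b) refl (ι N) (ι m) (inv (N ℕ.+ m)))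

  ratio≤1 : ratio ≤ 1ℚ
  ratio≤1 = subst₂ _≤_ (ℚP.+-identityʳ ratio)
    (trans (cong (_+_ ratio) (sym 1-ratio)) (solve 1 (λ r → r :+ (con 1ℚ :- r) := con 1ℚ) refl ratio))
    (ℚP.+-monoʳ-≤ ratio (0≤· (ℚP.+-mono-≤ (0≤1+q (0≤ι m)) (0≤ι m)) (0≤inv (N ℕ.+ m))))

0≤w : ∀ N m → m ℕ.≤ N → 0ℚ ≤ w N m
0≤w N zero    _   = ℚP.nonNegative⁻¹ 1ℚ
0≤w N (suc m) m<N = 0≤· (0≤w N m (ℕP.<⇒≤ m<N)) (0≤ratio N m m<N)

w≤1 : ∀ N m → m ℕ.≤ N → w N m ≤ 1ℚ
w≤1 N zero    _   = ℚP.≤-refl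
w≤1 N (suc m) m<N = *-mono-≤ (w N m) 1ℚ (ratio N m m<N) 1ℚ (0≤ratio N m m<N) (ℚP.nonNegative⁻¹ 1ℚ)
  (w≤1 N m (ℕP.<⇒≤ m<N)) (ratio≤1 N m m<N)

-- `w N m` is a product of factors 1 - (2j + 1)/(N + j + 1) over j < m, so 1 - w is at most the sum
-- of the (2j + 1)/(N + 1), and the first m odd numbers add up to m².
1-w≤ : ∀ N m → m ℕ.≤ N → 1ℚ - w N m ≤ ι m · ι m · inv N
1-w≤ N zero    _   = ℚP.≤-reflexive (sym (trans (cong (_· inv N) (ℚP.*-zeroˡ 0ℚ)) (ℚP.*-zeroˡ (inv N))))
1-w≤ N (suc m) m<N = begin
  1ℚ - w N m · r                                       ≡⟨ solve 2 (λ w r → con 1ℚ :- w :* r := (con 1ℚ :- w) :+ w :* (con 1ℚ :- r)) refl (w N m) r ⟩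
  (1ℚ - w N m) + w N m · (1ℚ - r)                      ≡⟨ cong (λ z → (1ℚ - w N m) + w N m · z) (1-ratio N m m<N) ⟩
  (1ℚ - w N m) + w N m · (d · inv (N ℕ.+ m))           ≤⟨ ℚP.+-mono-≤ (1-w≤ N m m≤N) (*-mono-≤ (w N m) 1ℚ (d · inv (N ℕ.+ m)) (d · inv N)
                                                            (0≤· 0≤d (0≤inv (N ℕ.+ m))) (ℚP.nonNegative⁻¹ 1ℚ) (w≤1 N m m≤N)
                                                            (*-mono-≤ d d (inv (N ℕ.+ m)) (inv N) (0≤inv (N ℕ.+ m)) 0≤d ℚP.≤-refl (inv-anti (ℕP.m≤m+n N m)))) ⟩
  ι m · ι m · inv N + 1ℚ · (d · inv N)                 ≡⟨ solve 2 (λ m b → m :* m :* b :+ con 1ℚ :* ((con 1ℚ :+ m :+ m) :* b) := (con 1ℚ :+ m) :* (con 1ℚ :+ m) :* b) refl (ι m) (inv N) ⟩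
  (1ℚ + ι m) · (1ℚ + ι m) · inv N                      ≡⟨ cong (λ z → z · z · inv N) (ι-suc m) ⟨
  ι (suc m) · ι (suc m) · inv N                        ∎
  where
  open ℚP.≤-Reasoning
  m≤N = ℕP.<⇒≤ m<N
  r = ratio N m m<N
  d = 1ℚ + ι m + ι m
  0≤d : 0ℚ ≤ d
  0≤d = ℚP.+-mono-≤ (0≤1+q (0≤ι m)) (0≤ι m)

-- `F` with every weight `w` replaced by its limit 1.
E : ℕ → ℕ → ℚ
E k N = ι 2 · ∑ (λ i → sgn i · inv² i ↑ k) N

-- One factor 1/m² absorbs the m² of `1-w≤`, so every term of the difference is at most 1/(N + 1);
-- since 0 ≤ w, it is also at most 1/m².
F≈E : ∀ k → F (suc k) ≈ E (suc k)
-- 4 is the factor 2 in `F` and `E` times the factor 2 in the tail bound.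
F≈E k = squeeze 4 λ M N → begin
  ∣ F (suc k) N - E (suc k) N ∣                           ≡⟨ cong ∣_∣ (difference N) ⟩
  ∣ ι 2 · ∑ (λ i → (- sgn i) · t N i) N ∣                 ≡⟨ ℚP.∣p*q∣≡∣p∣*∣q∣ (ι 2) (∑ (λ i → (- sgn i) · t N i) N) ⟩
  ι 2 · ∣ ∑ (λ i → (- sgn i) · t N i) N ∣                 ≤⟨ two·-mono (ℚP.≤-trans (∣∑∣≤ (λ i → (- sgn i) · t N i) N)
                                                               (∑-mono< N λ i i<N → ℚP.≤-reflexive (trans (∣sgn·∣ (suc i) (t N i)) (ℚP.0≤p⇒∣p∣≡p (0≤t N i i<N))))) ⟩
  ι 2 · ∑ (t N) N                                         ≤⟨ two·-mono (∑-dominated (t N) (inv N) N (0≤inv N) (t≤inv N) (t≤inv² N) M) ⟩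
  ι 2 · (ι M · inv N + ι 2 · inv M)                       ≡⟨ ℚP.+-identityˡ (ι 2 · (ι M · inv N + ι 2 · inv M)) ⟨
  0ℚ + ι 2 · (ι M · inv N + ι 2 · inv M)                  ≤⟨ ℚP.+-monoˡ-≤ (ι 2 · (ι M · inv N + ι 2 · inv M)) (0≤· (0≤ι 2) (0≤· (0≤ι M) (0≤inv N))) ⟩
  ι 2 · (ι M · inv N) + ι 2 · (ι M · inv N + ι 2 · inv M) ≡⟨ solve 2 (λ a b → con (ι 2) :* a :+ con (ι 2) :* (a :+ con (ι 2) :* b) := con (ι 4) :* (a :+ b)) refl (ι M · inv N) (inv M) ⟩
  ι 4 · (ι M · inv N + inv M)                             ∎
  where
  open ℚP.≤-Reasoning
  t : ℕ → ℕ → ℚ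
  t N i = (1ℚ - w N (suc i)) · inv² i ↑ suc k
  two·-mono : ∀ {p q} → p ≤ q → ι 2 · p ≤ ι 2 · q
  two·-mono = ℚP.*-monoˡ-≤-nonNeg (ι 2)
  difference : ∀ N → F (suc k) N - E (suc k) N ≡ ι 2 · ∑ (λ i → (- sgn i) · t N i) N
  difference N = trans (solve 3 (λ c a b → c :* a :- c :* b := c :* (a :+ (:- con 1ℚ) :* b)) refl (ι 2) (∑ (term (suc k) N) N) (∑ (λ i → sgn i · inv² i ↑ suc k) N))
    (cong (ι 2 ·_) (trans (cong (_+_ (∑ (term (suc k) N) N)) (sym (∑-· (- 1ℚ) (λ i → sgn i · inv² i ↑ suc k) N)))
      (trans (sym (∑-+ (term (suc k) N) _ N)) (∑-cong N λ i →
        solve 3 (λ s w x → s :* (w :* x) :+ (:- con 1ℚ) :* (s :* x) := (:- s) :* ((con 1ℚ :- w) :* x)) refl (sgn i) (w N (suc i)) (inv² i ↑ suc k)))))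
  0≤1-w : ∀ N i → i ℕ.< N → 0ℚ ≤ 1ℚ - w N (suc i)
  0≤1-w N i i<N = p≤q⇒0≤q-p (w≤1 N (suc i) i<N)
  0≤t : ∀ N i → i ℕ.< N → 0ℚ ≤ t N i
  0≤t N i i<N = 0≤· (0≤1-w N i i<N) (0≤↑ (suc k) (0≤inv² i))
  t≤inv : ∀ N i → i ℕ.< N → t N i ≤ inv N
  t≤inv N i i<N = begin
    (1ℚ - w N (suc i)) · (inv² i · inv² i ↑ k)            ≤⟨ *-mono-≤ (1ℚ - w N (suc i)) (m · m · inv N) (inv² i · inv² i ↑ k) (inv² i · 1ℚ) (0≤↑ (suc k) (0≤inv² i))
                                                                (0≤· (0≤· (0≤ι (suc i)) (0≤ι (suc i))) (0≤inv N)) (1-w≤ N (suc i) i<N)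
                                                                (*-mono-≤ (inv² i) (inv² i) (inv² i ↑ k) 1ℚ (0≤↑ k (0≤inv² i)) (0≤inv² i) ℚP.≤-refl (↑≤1 k (0≤inv² i) (inv²≤1 i))) ⟩
    m · m · inv N · (inv² i · 1ℚ)                         ≡⟨ solve 3 (λ m n x → m :* m :* n :* (x :* con 1ℚ) := m :* m :* x :* n) refl m (inv N) (inv² i) ⟩
    m · m · inv² i · inv N                                ≡⟨ cong (_· inv N) (ι²·inv² i) ⟩
    1ℚ · inv N                                            ≡⟨ ℚP.*-identityˡ (inv N) ⟩
    inv N                                                 ∎
    where m = ι (suc i)
  t≤inv² : ∀ N i → i ℕ.< N → t N i ≤ inv² i
  t≤inv² N i i<N = subst (t N i ≤_) (trans (ℚP.*-identityˡ (inv² i · 1ℚ)) (ℚP.*-identityʳ (inv² i)))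
    (*-mono-≤ (1ℚ - w N (suc i)) 1ℚ (inv² i · inv² i ↑ k) (inv² i · 1ℚ) (0≤↑ (suc k) (0≤inv² i)) (ℚP.nonNegative⁻¹ 1ℚ)
      (subst (1ℚ - w N (suc i) ≤_) (ℚP.+-identityʳ 1ℚ) (ℚP.+-monoʳ-≤ 1ℚ (ℚP.neg-antimono-≤ (0≤w N (suc i) i<N))))
      (*-mono-≤ (inv² i) (inv² i) (inv² i ↑ k) 1ℚ (0≤↑ k (0≤inv² i)) (0≤inv² i) ℚP.≤-refl (↑≤1 k (0≤inv² i) (inv²≤1 i))))

sgn-even : ∀ i → sgn (i ℕ.* 2) ≡ 1ℚ
sgn-even zero    = refl
sgn-even (suc i) = trans (solve 1 (λ a → :- (:- a) := a) refl (sgn (i ℕ.* 2))) (sgn-even i)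

¼ : ℚ
¼ = + 1 / 4

inv²-even : ∀ i → inv² (suc (i ℕ.* 2)) ≡ ¼ · inv² i
inv²-even i = trans (cong (λ q → q · q) (recip-· (suc i) 2))
  (solve 1 (λ a → (a :* con ½) :* (a :* con ½) := con ¼ :* (a :* a)) refl (inv i))

-- An alternating sum is the full sum minus twice its negative terms. Those belong to even n, and
-- taken up to 2N they amount to ¼ ↑ k times the power sum up to N.
E-even : ∀ k N → E k (N ℕ.* 2) ≡ ι 2 · p k (N ℕ.* 2) - ι 4 · (¼ ↑ k · p k N)
E-even k N = begin
  ι 2 · ∑ (λ i → sgn i · inv² i ↑ k) (N ℕ.* 2)      ≡⟨ cong (ι 2 ·_) (trans (∑-pairs (λ i → sgn i · inv² i ↑ k) N) (∑-cong N pair)) ⟩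
  ι 2 · ∑ (λ i → (inv² (i ℕ.* 2) ↑ k + inv² (suc (i ℕ.* 2)) ↑ k) + (- ι 2 · ¼ ↑ k) · inv² i ↑ k) N
    ≡⟨ cong (ι 2 ·_) (trans (∑-+ (λ i → inv² (i ℕ.* 2) ↑ k + inv² (suc (i ℕ.* 2)) ↑ k) (λ i → (- ι 2 · ¼ ↑ k) · inv² i ↑ k) N)
         (cong₂ _+_ (sym (∑-pairs (λ i → inv² i ↑ k) N)) (∑-· (- ι 2 · ¼ ↑ k) (λ i → inv² i ↑ k) N))) ⟩
  ι 2 · (p k (N ℕ.* 2) + (- ι 2 · ¼ ↑ k) · p k N)
    ≡⟨ solve 3 (λ a c b → con (ι 2) :* (a :+ :- con (ι 2) :* c :* b) := con (ι 2) :* a :- con (ι 4) :* (c :* b)) refl (p k (N ℕ.* 2)) (¼ ↑ k) (p k N) ⟩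
  ι 2 · p k (N ℕ.* 2) - ι 4 · (¼ ↑ k · p k N)       ∎
  where
  open ≡-Reasoning
  pair : ∀ i → sgn (i ℕ.* 2) · inv² (i ℕ.* 2) ↑ k + sgn (suc (i ℕ.* 2)) · inv² (suc (i ℕ.* 2)) ↑ k
             ≡ (inv² (i ℕ.* 2) ↑ k + inv² (suc (i ℕ.* 2)) ↑ k) + (- ι 2 · ¼ ↑ k) · inv² i ↑ k
  pair i = trans (cong (λ s → s · a + (- s) · b) (sgn-even i))
    (trans (solve 2 (λ a b → con 1ℚ :* a :+ (:- con 1ℚ) :* b := (a :+ b) :+ :- con (ι 2) :* b) refl a b)
      (cong (_+_ (a + b)) (trans (cong (λ z → - ι 2 · z) (trans (cong (_↑ k) (inv²-even i)) (·-↑ ¼ (inv² i) k)))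
        (sym (ℚP.*-assoc (- ι 2) (¼ ↑ k) (inv² i ↑ k))))))
    where
    a = inv² (i ℕ.* 2) ↑ k
    b = inv² (suc (i ℕ.* 2)) ↑ k

ζ-partialSum≡p : ∀ k N → partialSum (λ i → 1/ suc i ^ (2 ℕ.* k)) N ≡ p k N
ζ-partialSum≡p k N = trans (partialSum≡∑ (λ i → 1/ suc i ^ (2 ℕ.* k)) N)
  (∑-cong N λ i → trans (1/^≡inv↑ i (2 ℕ.* k)) (↑-double (inv i) k))

Cauchy-resp : ∀ {f g} → (∀ n → f n ≡ g n) → Cauchy f → Cauchy g
Cauchy-resp f≗g c ε 0<ε = let (N , h) = c ε 0<ε in
  N , λ m n N≤m N≤n → subst₂ (λ a b → ∣ a - b ∣ ≤ ε) (f≗g m) (f≗g n) (h m n N≤m N≤n)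

p-Cauchy : ∀ k → Cauchy (p (suc k))
p-Cauchy k = Cauchy-resp (ζ-partialSum≡p (suc k)) (ζ-Cauchy (2 ℕ.* suc k) (ℕP.*-monoʳ-≤ 2 (ℕ.s≤s (ℕ.z≤n {k}))))

n≤n*2 : ∀ n → n ℕ.≤ n ℕ.* 2
n≤n*2 n = ℕP.m≤m*n n 2

p-doubled : ∀ k → (λ N → p (suc k) (N ℕ.* 2)) ≈ p (suc k)
p-doubled k = Cauchy-reindex (ℕ._* 2) n≤n*2 (p-Cauchy k)

-- The claimed coefficient for k + 1: (2^(2k + 1) - 1) / 2^(2k) = 2 - 4^(-k).
c : ℕ → ℚ
c k = ι 2 - ¼ ↑ k

-- The power sums up to 2N and up to N in `E-even` are asymptotically equal, so their coefficients
-- combine to 2 - 4 · ¼ ↑ (k + 1) = c k.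
h-limit : ∀ k → (λ N → h (suc k) (N ℕ.* 2)) ≈ (λ N → c k · p (suc k) N)
h-limit k = ≈-trans h≈F (≈-trans (≈-reindex (ℕ._* 2) n≤n*2 (F≈E k))
  (≈-trans (≈-reflexive (E-even (suc k)))
  (≈-trans (+-cong (scale (ι 2) (p-doubled k)) (≈-reflexive λ _ → refl))
  (≈-reflexive λ N → solve 2 (λ q p → con (ι 2) :* p :- con (ι 4) :* ((con ¼ :* q) :* p) := (con (ι 2) :- q) :* p) refl (¼ ↑ k) (p (suc k) N)))))
  where
  h≈F : (λ N → h (suc k) (N ℕ.* 2)) ≈ (λ N → F (suc k) (N ℕ.* 2))
  h≈F = ≈-reflexive λ { zero → refl ; (suc N) → h≡F (suc k) (suc (N ℕ.* 2)) }

-- The Basel problem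

alt≡sgn· : ∀ n q → alt n q ≡ sgn n · q
alt≡sgn· zero    q = sym (ℚP.*-identityˡ q)
alt≡sgn· (suc n) q = trans (cong -_ (alt≡sgn· n q)) (ℚP.neg-distribˡ-* (sgn n) q)

odd⁻¹ : ℕ → ℚ
odd⁻¹ i = inv (i ℕ.+ i)

leibniz : ℕ → ℚ
leibniz = ∑ (λ i → sgn i · odd⁻¹ i)

oddSquares : ℕ → ℚ
oddSquares = ∑ (λ i → odd⁻¹ i · odd⁻¹ i)

alternatingHarmonic : ℕ → ℚ
alternatingHarmonic = ∑ (λ i → sgn i · inv i)

-- For i < N, a block of 2i + 1 consecutive alternating terms, with denominators from N - i to N +
-- i.
gap : ℕ → ℕ → ℚ
gap N i = alternatingHarmonic (N ℕ.+ i) - alternatingHarmonic (N ℕ.∸ suc i)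

-- In the square of Σ (-1)ⁿ / (2n + 1) over -N ≤ n < N, each off-diagonal term splits by
-- 1/(xy) = (1/x - 1/y) / (y - x); summing over y for fixed x = 2i + 1 leaves ± gap N i.
remainder : ℕ → ℚ
remainder N = ∑ (λ i → gap N i · odd⁻¹ i) N

-- Names the difference N - 1 - i, so that matching on `refl` removes truncated subtraction from the
-- arithmetic.
∃-complement : ∀ {i N} → i ℕ.< N → ∃ λ d → N ≡ suc (i ℕ.+ d)
∃-complement {i} i<N = let (d , eq) = ℕP.m≤n⇒∃[o]m+o≡n i<N in d , sym eq

-- The three summands are kept apart because each sums over i < N by itself: the first to a multiple
-- of `leibniz N`, the others to minus the lower and upper halves of `alternatingHarmonic (N + N)`.
correction : ℕ → ℕ → ℚ
correction N i = ι 4 · sgn N · (sgn i · odd⁻¹ i) + - 1ℚ · (sgn (N ℕ.∸ suc i) · inv (N ℕ.∸ suc i)) + - 1ℚ · (sgn (N ℕ.+ i) · inv (N ℕ.+ i))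

-- The block moves up by one, gaining 1/(N + i + 1) and losing 1/(N - i), whose signs are opposite
-- because the block has odd length. Multiplied by 1/(2i + 1), each splits into partial fractions
-- over 2N + 1 = 2(N + i + 1) - (2i + 1) = 2(N - i) + (2i + 1).
gap-step : ∀ N i → i ℕ.< N → gap (suc N) i · odd⁻¹ i ≡ gap N i · odd⁻¹ i + odd⁻¹ N · correction N i
gap-step N i i<N with ∃-complement i<N
... | d , refl = begin
  (L (N ℕ.+ i) + sgn (N ℕ.+ i) · a - L (suc N ℕ.∸ suc i)) · v
    ≡⟨ cong (λ k → (L (N ℕ.+ i) + sgn (N ℕ.+ i) · a - L k) · v) (trans (cong (ℕ._∸ i) (sym (ℕP.+-suc i d))) (ℕP.m+n∸m≡n i (suc d))) ⟩
  (L (N ℕ.+ i) + sgn (N ℕ.+ i) · a - (L d + sgn d · b)) · v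
    ≡⟨ solve 7 (λ l s a k t b v → (l :+ s :* a :- (k :+ t :* b)) :* v := (l :- k) :* v :+ (s :* (a :* v) :+ (:- t) :* (b :* v))) refl
         (L (N ℕ.+ i)) (sgn (N ℕ.+ i)) a (L d) (sgn d) b v ⟩
  (L (N ℕ.+ i) - L d) · v + (sgn (N ℕ.+ i) · (a · v) + - sgn d · (b · v))
    ≡⟨ cong (λ s → (L (N ℕ.+ i) - L d) · v + (sgn (N ℕ.+ i) · (a · v) + s · (b · v))) (sym sign) ⟩
  (L (N ℕ.+ i) - L d) · v + (sgn (N ℕ.+ i) · (a · v) + sgn (N ℕ.+ i) · (b · v))
    ≡⟨ cong (_+_ ((L (N ℕ.+ i) - L d) · v)) (cong₂ (λ x y → sgn (N ℕ.+ i) · x + sgn (N ℕ.+ i) · y) av bv) ⟩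
  (L (N ℕ.+ i) - L d) · v + (sgn (N ℕ.+ i) · (V · (ι 2 · v - a)) + sgn (N ℕ.+ i) · (V · (ι 2 · v + b)))
    ≡⟨ cong (_+_ ((L (N ℕ.+ i) - L d) · v))
         (solve 5 (λ s V v a b → s :* (V :* (con (ι 2) :* v :- a)) :+ s :* (V :* (con (ι 2) :* v :+ b))
           := V :* (con (ι 4) :* s :* v :+ :- con 1ℚ :* ((:- s) :* b) :+ :- con 1ℚ :* (s :* a))) refl (sgn (N ℕ.+ i)) V v a b) ⟩
  (L (N ℕ.+ i) - L d) · v + V · (ι 4 · sgn (N ℕ.+ i) · v + - 1ℚ · (- sgn (N ℕ.+ i) · b) + - 1ℚ · (sgn (N ℕ.+ i) · a))
    ≡⟨ cong₂ (λ x y → (L (N ℕ.+ i) - L d) · v + V · (x + - 1ℚ · (y · b) + - 1ℚ · (sgn (N ℕ.+ i) · a)))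
         (trans (cong (λ s → ι 4 · s · v) (sgn-+ N i)) (solve 4 (λ f s t v → f :* (s :* t) :* v := f :* s :* (t :* v)) refl (ι 4) (sgn N) (sgn i) v))
         (trans (cong -_ sign) (solve 1 (λ t → :- (:- t) := t) refl (sgn d))) ⟩
  (L (N ℕ.+ i) - L d) · v + V · (ι 4 · sgn N · (sgn i · v) + - 1ℚ · (sgn d · b) + - 1ℚ · (sgn (N ℕ.+ i) · a))
    ≡⟨ cong (λ k → (L (N ℕ.+ i) - L k) · v + V · (ι 4 · sgn N · (sgn i · v) + - 1ℚ · (sgn k · inv k) + - 1ℚ · (sgn (N ℕ.+ i) · a))) (ℕP.m+n∸m≡n i d) ⟨
  gap N i · odd⁻¹ i + V · correction N i ∎
  where
  open ≡-Reasoning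
  L = alternatingHarmonic
  a = inv (N ℕ.+ i)
  b = inv d
  v = odd⁻¹ i
  V = odd⁻¹ N
  ιN : ι N ≡ 1ℚ + (ι i + ι d)
  ιN = trans (ι-suc (i ℕ.+ d)) (cong (_+_ 1ℚ) (ι-+ i d))
  [1+d]b : (1ℚ + ι d) · b ≡ 1ℚ
  [1+d]b = trans (cong (_· b) (sym (ι-suc d))) (ι·inv d)
  sign : sgn (N ℕ.+ i) ≡ - sgn d
  sign = cong -_ (begin
    sgn (i ℕ.+ d ℕ.+ i)            ≡⟨ trans (sgn-+ (i ℕ.+ d) i) (cong (_· sgn i) (sgn-+ i d)) ⟩
    sgn i · sgn d · sgn i          ≡⟨ solve 2 (λ s t → s :* t :* s := t :* (s :* s)) refl (sgn i) (sgn d) ⟩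
    sgn d · (sgn i · sgn i)        ≡⟨ trans (cong (sgn d ·_) (sgn·sgn i)) (ℚP.*-identityʳ (sgn d)) ⟩
    sgn d                          ∎)
  av : a · v ≡ V · (ι 2 · v - a)
  av = begin
    a · v                                                         ≡⟨ ℚP.*-identityʳ (a · v) ⟨
    a · v · 1ℚ                                                    ≡⟨ cong (a · v ·_) ([1+N+m]·inv N N) ⟨
    a · v · ((1ℚ + ι N + ι N) · V)                                ≡⟨ solve 5 (λ a v n i V → a :* v :* ((con 1ℚ :+ n :+ n) :* V)
                                                                       := V :* (con (ι 2) :* v :* ((con 1ℚ :+ n :+ i) :* a) :- a :* ((con 1ℚ :+ i :+ i) :* v))) refl a v (ι N) (ι i) V ⟩
    V · (ι 2 · v · ((1ℚ + ι N + ι i) · a) - a · ((1ℚ + ι i + ι i) · v)) ≡⟨ cong₂ (λ x y → V · (ι 2 · v · x - a · y)) ([1+N+m]·inv N i) ([1+N+m]·inv i i) ⟩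
    V · (ι 2 · v · 1ℚ - a · 1ℚ)                                   ≡⟨ cong₂ (λ x y → V · (x - y)) (ℚP.*-identityʳ (ι 2 · v)) (ℚP.*-identityʳ a) ⟩
    V · (ι 2 · v - a)                                             ∎
  bv : b · v ≡ V · (ι 2 · v + b)
  bv = begin
    b · v                                                         ≡⟨ ℚP.*-identityʳ (b · v) ⟨
    b · v · 1ℚ                                                    ≡⟨ cong (b · v ·_) (trans (cong (λ n → (1ℚ + n + n) · V) (sym ιN)) ([1+N+m]·inv N N)) ⟨
    b · v · ((1ℚ + (1ℚ + (ι i + ι d)) + (1ℚ + (ι i + ι d))) · V)  ≡⟨ solve 5 (λ b v i d V → b :* v :* ((con 1ℚ :+ (con 1ℚ :+ (i :+ d)) :+ (con 1ℚ :+ (i :+ d))) :* V)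
                                                                       := V :* (con (ι 2) :* v :* ((con 1ℚ :+ d) :* b) :+ b :* ((con 1ℚ :+ i :+ i) :* v))) refl b v (ι i) (ι d) V ⟩
    V · (ι 2 · v · ((1ℚ + ι d) · b) + b · ((1ℚ + ι i + ι i) · v)) ≡⟨ cong₂ (λ x y → V · (ι 2 · v · x + b · y)) [1+d]b ([1+N+m]·inv i i) ⟩
    V · (ι 2 · v · 1ℚ + b · 1ℚ)                                   ≡⟨ cong₂ (λ x y → V · (x + y)) (ℚP.*-identityʳ (ι 2 · v)) (ℚP.*-identityʳ b) ⟩
    V · (ι 2 · v + b)                                             ∎

∑-correction : ∀ N → ∑ (correction N) N ≡ ι 4 · sgn N · leibniz N - alternatingHarmonic (N ℕ.+ N)
∑-correction N = begin
  ∑ (correction N) N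
    ≡⟨ trans (∑-+ (λ i → f i + g i) k N) (cong (_+ ∑ k N) (∑-+ f g N)) ⟩
  ∑ f N + ∑ g N + ∑ k N
    ≡⟨ cong₂ _+_ (cong₂ _+_ (∑-· (ι 4 · sgn N) (λ i → sgn i · odd⁻¹ i) N)
         (trans (∑-· (- 1ℚ) (λ i → sgn (N ℕ.∸ suc i) · inv (N ℕ.∸ suc i)) N) (cong (- 1ℚ ·_) (∑-reverse (λ i → sgn i · inv i) N))))
         (∑-· (- 1ℚ) (λ i → sgn (N ℕ.+ i) · inv (N ℕ.+ i)) N) ⟩
  ι 4 · sgn N · leibniz N + - 1ℚ · L N + - 1ℚ · R
    ≡⟨ solve 3 (λ a l r → a :+ :- con 1ℚ :* l :+ :- con 1ℚ :* r := a :- (l :+ r)) refl (ι 4 · sgn N · leibniz N) (L N) R ⟩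
  ι 4 · sgn N · leibniz N - (L N + R)
    ≡⟨ cong (λ z → ι 4 · sgn N · leibniz N - z) (∑-split (λ i → sgn i · inv i) N N) ⟨
  ι 4 · sgn N · leibniz N - L (N ℕ.+ N) ∎
  where
  open ≡-Reasoning
  L = alternatingHarmonic
  f g k : ℕ → ℚ
  f i = ι 4 · sgn N · (sgn i · odd⁻¹ i)
  g i = - 1ℚ · (sgn (N ℕ.∸ suc i) · inv (N ℕ.∸ suc i))
  k i = - 1ℚ · (sgn (N ℕ.+ i) · inv (N ℕ.+ i))
  R = ∑ (λ i → sgn (N ℕ.+ i) · inv (N ℕ.+ i)) N

-- The `alternatingHarmonic (N + N)` left over by the old terms cancels against the new term i = N,
-- whose gap is the whole alternating sum of 2N + 1 terms.
remainder-step : ∀ N → remainder (suc N) ≡ remainder N + odd⁻¹ N · (ι 4 · sgn N · leibniz N) + odd⁻¹ N · odd⁻¹ N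
remainder-step N = begin
  ∑ (λ i → gap (suc N) i · odd⁻¹ i) N + gap (suc N) N · V
    ≡⟨ cong₂ _+_ (trans (∑-cong< N (gap-step N)) (trans (∑-+ (λ i → gap N i · odd⁻¹ i) (λ i → V · correction N i) N)
         (cong (_+_ (remainder N)) (trans (∑-· V (correction N) N) (cong (V ·_) (∑-correction N)))))) (cong (_· V) last) ⟩
  remainder N + V · (ι 4 · sgn N · leibniz N - L (N ℕ.+ N)) + (L (N ℕ.+ N) + V) · V
    ≡⟨ solve 4 (λ r V a l → r :+ V :* (a :- l) :+ (l :+ V) :* V := r :+ V :* a :+ V :* V) refl (remainder N) V (ι 4 · sgn N · leibniz N) (L (N ℕ.+ N)) ⟩
  remainder N + V · (ι 4 · sgn N · leibniz N) + V · V ∎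
  where
  open ≡-Reasoning
  L = alternatingHarmonic
  V = odd⁻¹ N
  last : gap (suc N) N ≡ L (N ℕ.+ N) + V
  last = trans (cong₂ (λ k s → L (N ℕ.+ N) + s · V - L k) (ℕP.n∸n≡0 N) (trans (sgn-+ N N) (sgn·sgn N)))
    (solve 2 (λ l V → l :+ con 1ℚ :* V :- con 0ℚ := l :+ V) refl (L (N ℕ.+ N)) V)

-- The increments agree: 2(A + sV)² - 2A² = 4sAV + 2V², where one V² belongs to `oddSquares` and the
-- rest is `remainder-step`.
leibniz² : ∀ N → ι 2 · (leibniz N · leibniz N) ≡ oddSquares N + remainder N
leibniz² zero    = refl
leibniz² (suc N) = begin
  ι 2 · ((A + s · V) · (A + s · V))                          ≡⟨ solve 3 (λ A s V → con (ι 2) :* ((A :+ s :* V) :* (A :+ s :* V))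
                                                                  := con (ι 2) :* (A :* A) :+ V :* (con (ι 4) :* s :* A) :+ con (ι 2) :* (s :* s) :* (V :* V)) refl A s V ⟩
  ι 2 · (A · A) + V · (ι 4 · s · A) + ι 2 · (s · s) · (V · V) ≡⟨ cong₂ (λ x y → x + V · (ι 4 · s · A) + ι 2 · y · (V · V)) (leibniz² N) (sgn·sgn N) ⟩
  B + R + V · (ι 4 · s · A) + ι 2 · 1ℚ · (V · V)             ≡⟨ solve 4 (λ B R x y → B :+ R :+ x :+ con (ι 2) :* con 1ℚ :* y := B :+ y :+ (R :+ x :+ y)) refl B R (V · (ι 4 · s · A)) (V · V) ⟩
  B + V · V + (R + V · (ι 4 · s · A) + V · V)                ≡⟨ cong (_+_ (B + V · V)) (remainder-step N) ⟨
  oddSquares (suc N) + remainder (suc N)                     ∎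
  where
  open ≡-Reasoning
  A = leibniz N
  B = oddSquares N
  R = remainder N
  s = sgn N
  V = odd⁻¹ N

-- Up to sign, the block is an alternating sum of decreasing terms, which lies between 0 and its
-- first term 1/(N - i).
∣gap∣≤ : ∀ N i → i ℕ.< N → ∣ gap N i ∣ ≤ inv (N ℕ.∸ suc i)
∣gap∣≤ N i i<N with ∃-complement i<N
... | d , refl = subst (λ k → ∣ L (N ℕ.+ i) - L k ∣ ≤ inv k) (sym (ℕP.m+n∸m≡n i d)) (begin
  ∣ L (N ℕ.+ i) - L d ∣                           ≡⟨ cong (λ k → ∣ L k - L d ∣) (trans (cong (λ k → suc (k ℕ.+ i)) (ℕP.+-comm i d)) (trans (cong suc (ℕP.+-assoc d i i)) (sym (ℕP.+-suc d (i ℕ.+ i))))) ⟩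
  ∣ L (d ℕ.+ e) - L d ∣                           ≡⟨ cong (λ q → ∣ q - L d ∣) (∑-split (λ i → sgn i · inv i) d e) ⟩
  ∣ L d + ∑ (λ j → sgn (d ℕ.+ j) · inv (d ℕ.+ j)) e - L d ∣ ≡⟨ cong ∣_∣ (solve 2 (λ l r → l :+ r :- l := r) refl (L d) (∑ (λ j → sgn (d ℕ.+ j) · inv (d ℕ.+ j)) e)) ⟩
  ∣ ∑ (λ j → sgn (d ℕ.+ j) · inv (d ℕ.+ j)) e ∣   ≡⟨ cong ∣_∣ (trans (∑-cong e (λ j → trans (cong (_· inv (d ℕ.+ j)) (sgn-+ d j)) (ℚP.*-assoc (sgn d) (sgn j) (inv (d ℕ.+ j)))))
                                                       (∑-· (sgn d) (λ j → sgn j · inv (d ℕ.+ j)) e)) ⟩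
  ∣ sgn d · T ∣                                   ≡⟨ ∣sgn·∣ d T ⟩
  ∣ T ∣                                           ≡⟨ ℚP.0≤p⇒∣p∣≡p (subst (0ℚ ≤_) alt≡T (proj₁ bounds)) ⟩
  T                                               ≤⟨ subst (_≤ inv (d ℕ.+ 0)) alt≡T (proj₂ bounds) ⟩
  inv (d ℕ.+ 0)                                   ≤⟨ inv-anti (ℕP.m≤m+n d 0) ⟩
  inv d                                           ∎)
  where
  open ℚP.≤-Reasoning
  L = alternatingHarmonic
  e = suc (i ℕ.+ i)
  T = ∑ (λ j → sgn j · inv (d ℕ.+ j)) e
  bounds = alternating (λ j → inv (d ℕ.+ j)) (λ j → 0≤inv (d ℕ.+ j)) (λ j → inv-anti (ℕP.+-monoʳ-≤ d (ℕP.n≤1+n j))) e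
  alt≡T : partialSum (λ j → alt j (inv (d ℕ.+ j))) e ≡ T
  alt≡T = trans (partialSum≡∑ (λ j → alt j (inv (d ℕ.+ j))) e) (∑-cong e λ j → alt≡sgn· j (inv (d ℕ.+ j)))

-- The denominators N - i and i + 1 add up to N + 1.
inv·inv : ∀ N i → i ℕ.< N → inv (N ℕ.∸ suc i) · inv i ≡ inv N · (inv (N ℕ.∸ suc i) + inv i)
inv·inv N i i<N with ∃-complement i<N
... | d , refl = subst (λ k → inv k · inv i ≡ inv N · (inv k + inv i)) (sym (ℕP.m+n∸m≡n i d)) (begin
  inv d · inv i                                        ≡⟨ ℚP.*-identityʳ (inv d · inv i) ⟨
  inv d · inv i · 1ℚ                                   ≡⟨ cong (inv d · inv i ·_) (trans (cong (_· inv N) (sym split)) (ι·inv N)) ⟨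
  inv d · inv i · ((ι (suc i) + ι (suc d)) · inv N)    ≡⟨ solve 5 (λ b a m n c → b :* a :* ((m :+ n) :* c) := c :* (b :* (m :* a) :+ a :* (n :* b))) refl (inv d) (inv i) (ι (suc i)) (ι (suc d)) (inv N) ⟩
  inv N · (inv d · (ι (suc i) · inv i) + inv i · (ι (suc d) · inv d)) ≡⟨ cong₂ (λ x y → inv N · (inv d · x + inv i · y)) (ι·inv i) (ι·inv d) ⟩
  inv N · (inv d · 1ℚ + inv i · 1ℚ)                    ≡⟨ cong₂ (λ x y → inv N · (x + y)) (ℚP.*-identityʳ (inv d)) (ℚP.*-identityʳ (inv i)) ⟩
  inv N · (inv d + inv i)                              ∎)
  where
  open ≡-Reasoning
  split : ι (suc N) ≡ ι (suc i) + ι (suc d)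
  split = trans (cong (λ k → ι (suc k)) (sym (ℕP.+-suc i d))) (ι-+ (suc i) (suc d))

-- Terms before M are at most 1, later ones at most 1/(M + 1). Crude, but enough to make the
-- harmonic sum o(N), in the form that `squeeze` takes.
harmonic≤ : ∀ M N → ∑ inv N ≤ ι M + ι N · inv M
harmonic≤ M N with ℕP.≤-total N M
... | inj₁ N≤M = begin
  ∑ inv N               ≤⟨ ∑-mono< N (λ i _ → inv≤1 i) ⟩
  ∑ (λ _ → 1ℚ) N        ≡⟨ trans (∑-const 1ℚ N) (ℚP.*-identityʳ (ι N)) ⟩
  ι N                   ≤⟨ ι-mono N≤M ⟩
  ι M                   ≡⟨ ℚP.+-identityʳ (ι M) ⟨
  ι M + 0ℚ              ≤⟨ ℚP.+-monoʳ-≤ (ι M) (0≤· (0≤ι N) (0≤inv M)) ⟩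
  ι M + ι N · inv M     ∎
  where open ℚP.≤-Reasoning
... | inj₂ M≤N with ℕP.m≤n⇒∃[o]m+o≡n M≤N
... | d , refl = begin
  ∑ inv (M ℕ.+ d)                              ≡⟨ ∑-split inv M d ⟩
  ∑ inv M + ∑ (λ i → inv (M ℕ.+ i)) d          ≤⟨ ℚP.+-mono-≤ (∑-mono< M λ i _ → inv≤1 i) (∑-mono< d λ i _ → inv-anti (ℕP.m≤m+n M i)) ⟩
  ∑ (λ _ → 1ℚ) M + ∑ (λ _ → inv M) d           ≡⟨ cong₂ _+_ (trans (∑-const 1ℚ M) (ℚP.*-identityʳ (ι M))) (∑-const (inv M) d) ⟩
  ι M + ι d · inv M                            ≤⟨ ℚP.+-monoʳ-≤ (ι M) (*-mono-≤ (ι d) (ι (M ℕ.+ d)) (inv M) (inv M) (0≤inv M) (0≤ι (M ℕ.+ d)) (ι-mono (ℕP.m≤n+m d M)) ℚP.≤-refl) ⟩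
  ι M + ι (M ℕ.+ d) · inv M                    ∎
  where open ℚP.≤-Reasoning

-- By `∣gap∣≤` and `inv·inv` the remainder is at most 2/(N + 1) times the harmonic sum.
∣remainder∣≤ : ∀ M N → ∣ remainder N ∣ ≤ ι 2 · (ι M · inv N + inv M)
∣remainder∣≤ M N = begin
  ∣ remainder N ∣                                              ≤⟨ ∣∑∣≤ (λ i → gap N i · odd⁻¹ i) N ⟩
  ∑ (λ i → ∣ gap N i · odd⁻¹ i ∣) N                            ≤⟨ ∑-mono< N bound-term ⟩
  ∑ (λ i → inv N · (inv (N ℕ.∸ suc i) + inv i)) N              ≡⟨ trans (∑-· (inv N) (λ i → inv (N ℕ.∸ suc i) + inv i) N)
                                                                    (cong (inv N ·_) (trans (∑-+ (λ i → inv (N ℕ.∸ suc i)) inv N) (cong (_+ ∑ inv N) (∑-reverse inv N)))) ⟩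
  inv N · (∑ inv N + ∑ inv N)                                  ≤⟨ ℚP.*-monoˡ-≤-nonNeg (inv N) {{ℚ.nonNegative (0≤inv N)}} (ℚP.+-mono-≤ (harmonic≤ M N) (harmonic≤ M N)) ⟩
  inv N · (ι M + ι N · inv M + (ι M + ι N · inv M))            ≡⟨ solve 4 (λ a m n b → a :* (m :+ n :* b :+ (m :+ n :* b)) := con (ι 2) :* (m :* a :+ (n :* a) :* b)) refl (inv N) (ι M) (ι N) (inv M) ⟩
  ι 2 · (ι M · inv N + ι N · inv N · inv M)                    ≤⟨ ℚP.*-monoˡ-≤-nonNeg (ι 2) (ℚP.+-monoʳ-≤ (ι M · inv N) (ℚP.≤-trans
                                                                    (*-mono-≤ (ι N · inv N) 1ℚ (inv M) (inv M) (0≤inv M) (ℚP.nonNegative⁻¹ 1ℚ) ιinv≤1 ℚP.≤-refl)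
                                                                    (ℚP.≤-reflexive (ℚP.*-identityˡ (inv M))))) ⟩
  ι 2 · (ι M · inv N + inv M)                                  ∎
  where
  open ℚP.≤-Reasoning
  ιinv≤1 : ι N · inv N ≤ 1ℚ
  ιinv≤1 = subst (ι N · inv N ≤_) (ι·inv N) (*-mono-≤ (ι N) (ι (suc N)) (inv N) (inv N) (0≤inv N) (0≤ι (suc N)) (ι-mono (ℕP.n≤1+n N)) ℚP.≤-refl)
  bound-term : ∀ i → i ℕ.< N → ∣ gap N i · odd⁻¹ i ∣ ≤ inv N · (inv (N ℕ.∸ suc i) + inv i)
  bound-term i i<N = begin
    ∣ gap N i · odd⁻¹ i ∣                            ≡⟨ trans (ℚP.∣p*q∣≡∣p∣*∣q∣ (gap N i) (odd⁻¹ i)) (cong (∣ gap N i ∣ ·_) (ℚP.0≤p⇒∣p∣≡p (0≤inv (i ℕ.+ i)))) ⟩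
    ∣ gap N i ∣ · odd⁻¹ i                            ≤⟨ *-mono-≤ (∣ gap N i ∣) (inv (N ℕ.∸ suc i)) (odd⁻¹ i) (inv i) (0≤inv (i ℕ.+ i)) (0≤inv (N ℕ.∸ suc i))
                                                          (∣gap∣≤ N i i<N) (inv-anti (ℕP.m≤m+n i i)) ⟩
    inv (N ℕ.∸ suc i) · inv i                        ≡⟨ inv·inv N i i<N ⟩
    inv N · (inv (N ℕ.∸ suc i) + inv i)              ∎

2leibniz²≈oddSquares : (λ N → ι 2 · (leibniz N · leibniz N)) ≈ oddSquares
2leibniz²≈oddSquares = squeeze 2 λ M N → subst (λ q → ∣ q ∣ ≤ ι 2 · (ι M · inv N + inv M))
  (sym (trans (cong (_- oddSquares N) (leibniz² N)) (solve 2 (λ b r → b :+ r :- b := r) refl (oddSquares N) (remainder N))))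
  (∣remainder∣≤ M N)

n*2≡n+n : ∀ n → n ℕ.* 2 ≡ n ℕ.+ n
n*2≡n+n n = trans (ℕP.*-comm n 2) (cong (n ℕ.+_) (ℕP.+-identityʳ n))

p₁-split : ∀ N → p 1 (N ℕ.* 2) ≡ oddSquares N + ¼ · p 1 N
p₁-split N = trans (∑-pairs (λ i → inv² i ↑ 1) N)
  (trans (∑-+ (λ i → inv² (i ℕ.* 2) ↑ 1) (λ i → inv² (suc (i ℕ.* 2)) ↑ 1) N)
    (cong₂ _+_
      (∑-cong N λ i → trans (ℚP.*-identityʳ (inv² (i ℕ.* 2))) (cong (λ k → inv k · inv k) (n*2≡n+n i)))
      (trans (∑-cong N λ i → trans (cong (_· 1ℚ) (inv²-even i)) (ℚP.*-assoc ¼ (inv² i) 1ℚ)) (∑-· ¼ (λ i → inv² i ↑ 1) N))))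

πₙ : ℕ → ℚ
πₙ = approx π

πₙ≡4leibniz : ∀ N → πₙ N ≡ ι 4 · leibniz N
πₙ≡4leibniz N = cong (ι 4 ·_) (trans (partialSum≡∑ leibnizTerm N) (∑-cong N λ i →
  trans (/-alt i (suc (2 ℕ.* i))) (trans (alt≡sgn· i (inv (2 ℕ.* i)))
    (cong (λ k → sgn i · inv k) (cong (i ℕ.+_) (ℕP.+-identityʳ i))))))

π²ₙ : ℕ → ℚ
π²ₙ N = πₙ N · πₙ N

-- ζ(2) is 4/3 of the sum over odd squares, hence 4/3 · 2 · (π/4)². In p = 4/3 · (p - ¼ p) only the
-- first p is moved from N to 2N, which leaves exactly the odd squares.
basel : p 1 ≈ (λ N → + 1 / 6 · π²ₙ N)
basel =
  ≈-trans (≈-reflexive λ N → solve 1 (λ p → p := con (+ 4 / 3) :* (p :- con ¼ :* p)) refl (p 1 N)) $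
  ≈-trans (scale (+ 4 / 3) (+-cong (≈-sym (p-doubled 0)) (≈-reflexive λ _ → refl))) $
  ≈-trans (≈-reflexive λ N → trans (cong (λ q → + 4 / 3 · (q - ¼ · p 1 N)) (p₁-split N))
    (solve 2 (λ b p → con (+ 4 / 3) :* (b :+ con ¼ :* p :- con ¼ :* p) := con (+ 4 / 3) :* b) refl (oddSquares N) (p 1 N))) $
  ≈-trans (scale (+ 4 / 3) (≈-sym 2leibniz²≈oddSquares)) $
  ≈-reflexive λ N → trans
    (solve 1 (λ l → con (+ 4 / 3) :* (con (ι 2) :* (l :* l)) := con (+ 1 / 6) :* ((con (ι 4) :* l) :* (con (ι 4) :* l))) refl (leibniz N))
    (cong (λ q → + 1 / 6 · (q · q)) (sym (πₙ≡4leibniz N)))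

-- Newton's identities

-- conv f g k = Σ f i · g j over i + j = k.
conv : (ℕ → ℚ) → (ℕ → ℚ) → ℕ → ℚ
conv f g zero    = f 0 · g 0
conv f g (suc k) = f 0 · g (suc k) + conv (f ∘ suc) g k

conv-last : ∀ f g k → conv f g (suc k) ≡ conv f (g ∘ suc) k + f (suc k) · g 0
conv-last f g zero    = refl
conv-last f g (suc k) = trans (cong (_+_ (f 0 · g (suc (suc k)))) (conv-last (f ∘ suc) g k))
  (sym (ℚP.+-assoc (f 0 · g (suc (suc k))) (conv (f ∘ suc) (g ∘ suc) k) (f (suc (suc k)) · g 0)))

conv-+ˡ : ∀ f f′ g k → conv (λ i → f i + f′ i) g k ≡ conv f g k + conv f′ g k
conv-+ˡ f f′ g zero    = ℚP.*-distribʳ-+ (g 0) (f 0) (f′ 0)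
conv-+ˡ f f′ g (suc k) = trans (cong (_+_ ((f 0 + f′ 0) · g (suc k))) (conv-+ˡ (f ∘ suc) (f′ ∘ suc) g k))
  (solve 5 (λ a b g x y → (a :+ b) :* g :+ (x :+ y) := a :* g :+ x :+ (b :* g :+ y)) refl
    (f 0) (f′ 0) (g (suc k)) (conv (f ∘ suc) g k) (conv (f′ ∘ suc) g k))

conv-·ˡ : ∀ a f g k → conv (λ i → a · f i) g k ≡ a · conv f g k
conv-·ˡ a f g zero    = ℚP.*-assoc a (f 0) (g 0)
conv-·ˡ a f g (suc k) = trans (cong (_+_ (a · f 0 · g (suc k))) (conv-·ˡ a (f ∘ suc) g k))
  (solve 4 (λ a x y z → a :* x :* y :+ a :* z := a :* (x :* y :+ z)) refl a (f 0) (g (suc k)) (conv (f ∘ suc) g k))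

conv-zeroˡ : ∀ g k → conv (λ _ → 0ℚ) g k ≡ 0ℚ
conv-zeroˡ g zero    = ℚP.*-zeroˡ (g 0)
conv-zeroˡ g (suc k) = trans (cong₂ _+_ (ℚP.*-zeroˡ (g (suc k))) (conv-zeroˡ g k)) (ℚP.+-identityˡ 0ℚ)

H : ℕ → ℕ → ℚ
H N k = h k N

P : ℕ → ℕ → ℚ
P N i = p (suc i) N

conv-h-step : ∀ f N k → conv f (H (suc N)) (suc k) ≡ conv f (H N) (suc k) + inv² N · conv f (H (suc N)) k
conv-h-step f N zero    = solve 5 (λ a b x y z → a :* (x :+ y :* con 1ℚ) :+ b :* con 1ℚ := a :* x :+ b :* con 1ℚ :+ y :* (a :* con 1ℚ)) refl
  (f 0) (f 1) (h 1 N) (inv² N) 0ℚ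
conv-h-step f N (suc k) = trans (cong (_+_ (f 0 · h (suc (suc k)) (suc N))) (conv-h-step (f ∘ suc) N k))
  (solve 6 (λ a x X y c d → a :* (x :+ X :* y) :+ (c :+ X :* d) := a :* x :+ c :+ X :* (a :* y :+ d)) refl
    (f 0) (h (suc (suc k)) N) (inv² N) (h (suc k) (suc N)) (conv (f ∘ suc) (H N) (suc k)) (conv (f ∘ suc) (H (suc N)) k))

-- Unrolling the recurrence of `h` sorts the monomials by the exponent of the last variable X: h k
-- (N + 1) = Σ Xⁱ h (k - i) N.
conv-geometric : ∀ N k → conv (λ i → inv² N ↑ suc i) (H N) k ≡ inv² N · h k (suc N)
conv-geometric N zero    = cong (_· 1ℚ) (ℚP.*-identityʳ (inv² N))
conv-geometric N (suc k) = trans (cong₂ (λ u v → u · h (suc k) N + v) (ℚP.*-identityʳ (inv² N))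
    (trans (conv-·ˡ (inv² N) (λ i → inv² N ↑ suc i) (H N) k) (cong (inv² N ·_) (conv-geometric N k))))
  (sym (ℚP.*-distribˡ-+ (inv² N) (h (suc k) N) (inv² N · h k (suc N))))

-- The recurrence of `h` yields k + 2 copies of X h (k + 1) (N + 1): one is the contribution of X to
-- the power sums, by `conv-geometric`, and the other k + 1 are the identity for the smaller k.
newton : ∀ N k → ι (suc k) · h (suc k) N ≡ conv (P N) (H N) k
newton zero    k       = trans (ℚP.*-zeroʳ (ι (suc k))) (sym (conv-zeroˡ (H 0) k))
newton (suc N) zero    = begin
  1ℚ · (h 1 N + X · 1ℚ)                              ≡⟨ solve 2 (λ a X → con 1ℚ :* (a :+ X :* con 1ℚ) := con 1ℚ :* a :+ X :* con 1ℚ :* con 1ℚ) refl (h 1 N) X ⟩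
  1ℚ · h 1 N + X · 1ℚ · 1ℚ                           ≡⟨ cong (_+ X · 1ℚ · 1ℚ) (newton N 0) ⟩
  p 1 N · 1ℚ + X · 1ℚ · 1ℚ                           ≡⟨ ℚP.*-distribʳ-+ 1ℚ (p 1 N) (X · 1ℚ) ⟨
  (p 1 N + X · 1ℚ) · 1ℚ                              ∎
  where
  open ≡-Reasoning
  X = inv² N
newton (suc N) (suc k) = begin
  ι (suc (suc k)) · (h (suc (suc k)) N + X · h (suc k) (suc N))
    ≡⟨ ℚP.*-distribˡ-+ (ι (suc (suc k))) (h (suc (suc k)) N) (X · h (suc k) (suc N)) ⟩
  ι (suc (suc k)) · h (suc (suc k)) N + ι (suc (suc k)) · (X · h (suc k) (suc N))
    ≡⟨ cong₂ (λ u v → u + v · (X · h (suc k) (suc N))) (newton N (suc k)) (ι-suc (suc k)) ⟩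
  conv (P N) (H N) (suc k) + (1ℚ + ι (suc k)) · (X · h (suc k) (suc N))
    ≡⟨ solve 4 (λ a n X y → a :+ (con 1ℚ :+ n) :* (X :* y) := a :+ X :* y :+ X :* (n :* y)) refl (conv (P N) (H N) (suc k)) (ι (suc k)) X (h (suc k) (suc N)) ⟩
  conv (P N) (H N) (suc k) + X · h (suc k) (suc N) + X · (ι (suc k) · h (suc k) (suc N))
    ≡⟨ cong₂ (λ u v → conv (P N) (H N) (suc k) + u + X · v) (sym (conv-geometric N (suc k))) (newton (suc N) k) ⟩
  conv (P N) (H N) (suc k) + conv (λ i → X ↑ suc i) (H N) (suc k) + X · conv (P (suc N)) (H (suc N)) k
    ≡⟨ cong (_+ X · conv (P (suc N)) (H (suc N)) k) (conv-+ˡ (P N) (λ i → X ↑ suc i) (H N) (suc k)) ⟨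
  conv (P (suc N)) (H N) (suc k) + X · conv (P (suc N)) (H (suc N)) k
    ≡⟨ conv-h-step (P (suc N)) N k ⟨
  conv (P (suc N)) (H (suc N)) (suc k) ∎
  where
  open ≡-Reasoning
  X = inv² N

-- The recursion for the even zeta values

·-bounded : ∀ {f g} → Bounded f → Bounded g → Bounded (λ n → f n · g n)
·-bounded {f} {g} (M , B , 0<B , f≤) (N , C , 0<C , g≤) =
  let (K , H) = eventually-× (M , f≤) (N , g≤)
  in K , B · C , ℚP.positive⁻¹ (B · C) {{ℚP.pos*pos⇒pos B {{ℚ.positive 0<B}} C {{ℚ.positive 0<C}}}} , λ n K≤n →
    subst (_≤ B · C) (sym (ℚP.∣p*q∣≡∣p∣*∣q∣ (f n) (g n)))
      (*-mono-≤ (∣ f n ∣) B (∣ g n ∣) C (ℚP.0≤∣p∣ (g n)) (ℚP.<⇒≤ 0<B) (proj₁ (H n K≤n)) (proj₂ (H n K≤n)))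

module _ {Q : ℕ → ℚ} (Q-bounded : Bounded Q) where

  monomial-bounded : ∀ r k → Bounded (λ n → r · Q n ↑ k)
  monomial-bounded r k = ·-bounded (const-bounded r) (↑-bounded k)
    where
    ↑-bounded : ∀ k → Bounded (λ n → Q n ↑ k)
    ↑-bounded zero    = const-bounded 1ℚ
    ↑-bounded (suc k) = ·-bounded Q-bounded (↑-bounded k)

  monomial-cong : ∀ {f g} r s a b → f ≈ (λ n → r · Q n ↑ a) → g ≈ (λ n → s · Q n ↑ b) →
    (λ n → f n · g n) ≈ (λ n → r · s · Q n ↑ (a ℕ.+ b))
  monomial-cong r s a b f≈ g≈ = ≈-trans (·-cong (monomial-bounded r a) (monomial-bounded s b) f≈ g≈)
    (≈-reflexive λ n → trans
      (solve 4 (λ r s x y → r :* x :* (s :* y) := r :* s :* (x :* y)) refl r s (Q n ↑ a) (Q n ↑ b))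
      (cong (r · s ·_) (sym (↑-+ (Q n) a b))))

  -- The offset a is general because the induction drops the first entry of f, which raises its
  -- exponents by one.
  conv-monomials : ∀ {f g : ℕ → ℕ → ℚ} (r s : ℕ → ℚ) a b k →
    (∀ i → i ℕ.≤ k → (λ n → f n i) ≈ (λ n → r i · Q n ↑ (a ℕ.+ i))) →
    (∀ i → i ℕ.≤ k → (λ n → g n i) ≈ (λ n → s i · Q n ↑ (b ℕ.+ i))) →
    (λ n → conv (f n) (g n) k) ≈ (λ n → conv r s k · Q n ↑ (a ℕ.+ b ℕ.+ k))
  conv-monomials r s a b zero    f≈ g≈ = ≈-trans (monomial-cong (r 0) (s 0) (a ℕ.+ 0) (b ℕ.+ 0) (f≈ 0 ℕ.z≤n) (g≈ 0 ℕ.z≤n))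
    (≈-reflexive λ n → cong (λ e → r 0 · s 0 · Q n ↑ e)
      (trans (cong₂ ℕ._+_ (ℕP.+-identityʳ a) (ℕP.+-identityʳ b)) (sym (ℕP.+-identityʳ (a ℕ.+ b)))))
  conv-monomials r s a b (suc k) f≈ g≈ = ≈-trans
    (+-cong
      (monomial-cong (r 0) (s (suc k)) (a ℕ.+ 0) (b ℕ.+ suc k) (f≈ 0 ℕ.z≤n) (g≈ (suc k) ℕP.≤-refl))
      (conv-monomials (r ∘ suc) s (suc a) b k
        (λ i i≤k → ≈-trans (f≈ (suc i) (ℕ.s≤s i≤k)) (≈-reflexive λ n → cong (λ e → r (suc i) · Q n ↑ e) (ℕP.+-suc a i)))
        (λ i i≤k → g≈ i (ℕP.m≤n⇒m≤1+n i≤k))))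
    (≈-reflexive λ n → trans
      (cong₂ (λ d e → r 0 · s (suc k) · Q n ↑ d + conv (r ∘ suc) s k · Q n ↑ e)
        (trans (cong (ℕ._+ (b ℕ.+ suc k)) (ℕP.+-identityʳ a)) (sym (ℕP.+-assoc a b (suc k))))
        (sym (ℕP.+-suc (a ℕ.+ b) k)))
      (sym (ℚP.*-distribʳ-+ (Q n ↑ (a ℕ.+ b ℕ.+ suc k)) (r 0 · s (suc k)) (conv (r ∘ suc) s k))))

π²-bounded : Bounded π²ₙ
π²-bounded = bound π²ₙ (cauchy (π Defs.* π))

module EvenZeta (r : ℕ → ℚ) (r₀ : r 0 ≡ + 1 / 6) (K : ℕ)
  (coefficient≢0 : ∀ k → ℚ.NonZero (ι (suc (suc k)) · c (suc k) - 1ℚ))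
  (recursion : ∀ k → k ℕ.< K → (ι (suc (suc k)) · c (suc k) - 1ℚ) · r (suc k) ≡ conv r (λ j → c j · r j) k) where

  Even : ℕ → Set
  Even k = p (suc k) ≈ (λ n → r k · π²ₙ n ↑ suc k)

  -- Newton's identity at 2n contains p (k + 2) in h (k + 2), asymptotically c (k + 1) · p (k + 2),
  -- and in the last summand p (k + 2) · h 0. Collecting both gives `coeff`; every other factor
  -- falls under the induction hypothesis.
  Even-suc : ∀ k → k ℕ.< K → (∀ i → i ℕ.≤ k → Even i) → Even (suc k)
  Even-suc k k<K ih = scale-cancel coeff {{coefficient≢0 k}} $
    ≈-trans (≈-reflexive λ n → solve 3 (λ a c p → (a :* c :- con 1ℚ) :* p := a :* (c :* p) :- p) refl (ι (suc (suc k))) (c (suc k)) (p (suc (suc k)) n)) $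
    ≈-trans (+-cong (scale (ι (suc (suc k))) (≈-sym (h-limit (suc k))))
      (≈-trans (≈-reflexive λ n → solve 1 (λ p → :- p := (:- con 1ℚ) :* p) refl (p (suc (suc k)) n)) (scale (- 1ℚ) (≈-sym (p-doubled (suc k)))))) $
    ≈-trans (≈-reflexive λ n → newton′ (n ℕ.* 2)) $
    ≈-trans (conv-monomials π²-bounded r (λ j → c j · r j) 1 1 k
      (λ i i≤k → ≈-trans (p-doubled i) (ih i i≤k))
      (λ j j≤k → ≈-trans (h-limit j) (≈-trans (scale (c j) (ih j j≤k)) (≈-reflexive λ n → sym (ℚP.*-assoc (c j) (r j) (π²ₙ n ↑ suc j)))))) $
    ≈-reflexive λ n → trans (cong (_· π²ₙ n ↑ suc (suc k)) (sym (recursion k k<K))) (ℚP.*-assoc coeff (r (suc k)) (π²ₙ n ↑ suc (suc k)))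
    where
    coeff = ι (suc (suc k)) · c (suc k) - 1ℚ
    newton′ : ∀ N → ι (suc (suc k)) · h (suc (suc k)) N + - 1ℚ · p (suc (suc k)) N ≡ conv (P N) (λ j → h (suc j) N) k
    newton′ N = trans (cong (_+ - 1ℚ · p (suc (suc k)) N) (trans (newton N (suc k)) (conv-last (P N) (H N) k)))
      (solve 2 (λ a p → a :+ p :* con 1ℚ :+ (:- con 1ℚ) :* p := a) refl (conv (P N) (λ j → h (suc j) N) k) (p (suc (suc k)) N))

  evens : ∀ k → k ℕ.≤ K → ∀ i → i ℕ.≤ k → Even i
  evens zero    _   zero _   = ≈-trans basel (≈-reflexive λ n → cong₂ _·_ (sym r₀) (sym (ℚP.*-identityʳ (π²ₙ n))))
  evens (suc k) k<K i    i≤k with ℕP.m≤n⇒m<n∨m≡n i≤k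
  ... | inj₁ (ℕ.s≤s i≤k′) = evens k (ℕP.<⇒≤ k<K) i i≤k′
  ... | inj₂ refl         = Even-suc k k<K (evens k (ℕP.<⇒≤ k<K))

  even : ∀ k → k ℕ.≤ K → Even k
  even k k≤K = evens k k≤K k ℕP.≤-refl

-- Partitions

module _ {A : Set} (f : A → ℚ) (0≤f : ∀ a → 0ℚ ≤ f a) where

  sum-nonNeg : ∀ xs → 0ℚ ≤ sum (map f xs)
  sum-nonNeg []       = ℚP.≤-refl
  sum-nonNeg (x ∷ xs) = ℚP.+-mono-≤ (0≤f x) (sum-nonNeg xs)

  sum-insert : ∀ x xs ys → sum (map f (xs ++ x ∷ ys)) ≡ f x + sum (map f (xs ++ ys))
  sum-insert x []       ys = refl
  sum-insert x (z ∷ xs) ys = trans (cong (_+_ (f z)) (sum-insert x xs ys))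
    (solve 3 (λ a b c → a :+ (b :+ c) := b :+ (a :+ c)) refl (f z) (f x) (sum (map f (xs ++ ys))))

  sum-⊆ : ∀ {xs ys} → Unique xs → xs ⊆ ys → sum (map f xs) ≤ sum (map f ys)
  sum-⊆ {[]}     {ys} _        _   = sum-nonNeg ys
  sum-⊆ {x ∷ xs} {ys} (x∉ ∷ u) sub with ∈-∃++ (sub (here refl))
  ... | as , bs , refl = subst (f x + sum (map f xs) ≤_) (sym (sum-insert x as bs))
    (ℚP.+-monoʳ-≤ (f x) (sum-⊆ u sub′))
    where
    sub′ : xs ⊆ as ++ bs
    sub′ z∈xs with ∈-++⁻ as (sub (there z∈xs))
    ... | inj₁ z∈as         = ∈-++⁺ˡ z∈as
    ... | inj₂ (here refl)  = ⊥-elim (All.lookup x∉ z∈xs refl)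
    ... | inj₂ (there z∈bs) = ∈-++⁺ʳ as z∈bs

sum-++ : ∀ xs ys → sum (xs ++ ys) ≡ sum xs + sum ys
sum-++ []       ys = sym (ℚP.+-identityˡ (sum ys))
sum-++ (x ∷ xs) ys = trans (cong (_+_ x) (sum-++ xs ys)) (sym (ℚP.+-assoc x (sum xs) (sum ys)))

-- Total thanks to `pred`, so that sums over lists of parts carry no positivity proofs.
weight : List ℕ → ℚ
weight []       = 1ℚ
weight (a ∷ as) = inv² (ℕ.pred a) · weight as

0≤weight : ∀ as → 0ℚ ≤ weight as
0≤weight []       = ℚP.nonNegative⁻¹ 1ℚ
0≤weight (a ∷ as) = 0≤· (0≤inv² (ℕ.pred a)) (0≤weight as)

1/[m*n]^2 : ∀ m n .{{_ : NonZero m}} .{{_ : NonZero n}} .{{_ : NonZero (m ℕ.* n)}} → 1/ (m ℕ.* n) ^ 2 ≡ inv² (ℕ.pred m) · 1/ n ^ 2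
1/[m*n]^2 (suc m) (suc n) = begin
  1/ (suc m ℕ.* suc n) ^ 2                       ≡⟨ 1/^≡inv↑ (n ℕ.+ m ℕ.* suc n) 2 ⟩
  inv (n ℕ.+ m ℕ.* suc n) ↑ 2                    ≡⟨ cong (_↑ 2) (recip-· (suc m) (suc n)) ⟩
  (inv m · inv n) ↑ 2                            ≡⟨ solve 2 (λ a b → a :* b :* (a :* b :* con 1ℚ) := a :* a :* (b :* (b :* con 1ℚ))) refl (inv m) (inv n) ⟩
  inv² m · inv n ↑ 2                             ≡⟨ cong (inv² m ·_) (1/^≡inv↑ n 2) ⟨
  inv² m · 1/ suc n ^ 2                          ∎
  where open ≡-Reasoning

1/product^2≡weight : ∀ {as} (pos : All NonZero as) → (1/ product as ^ 2) {{product≢0 pos}} ≡ weight as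
1/product^2≡weight []                = refl
1/product^2≡weight {a ∷ as} (pa ∷ pas) = trans
  (1/[m*n]^2 a (product as) {{pa}} {{product≢0 pas}} {{product≢0 (pa ∷ pas)}})
  (cong (inv² (ℕ.pred a) ·_) (1/product^2≡weight pas))

-- Follows the recurrence of `h`: either N + 1 is the largest part and is removed once, or all parts
-- are at most N.
enumerate : ℕ → ℕ → List (List ℕ)
enumerate zero    N       = [] ∷ []
enumerate (suc k) zero    = []
enumerate (suc k) (suc N) = map (suc N ∷_) (enumerate k (suc N)) ++ enumerate (suc k) N

sum-enumerate : ∀ k N → sum (map weight (enumerate k N)) ≡ h k N
sum-enumerate zero    N       = refl
sum-enumerate (suc k) zero    = refl
sum-enumerate (suc k) (suc N) = begin
  sum (map weight (map (suc N ∷_) (enumerate k (suc N)) ++ enumerate (suc k) N))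
    ≡⟨ trans (cong sum (map-++ weight (map (suc N ∷_) (enumerate k (suc N))) (enumerate (suc k) N)))
         (sum-++ (map weight (map (suc N ∷_) (enumerate k (suc N)))) (map weight (enumerate (suc k) N))) ⟩
  sum (map weight (map (suc N ∷_) (enumerate k (suc N)))) + sum (map weight (enumerate (suc k) N))
    ≡⟨ cong₂ _+_ (trans (cons (enumerate k (suc N))) (cong (inv² N ·_) (sum-enumerate k (suc N)))) (sum-enumerate (suc k) N) ⟩
  inv² N · h k (suc N) + h (suc k) N
    ≡⟨ ℚP.+-comm (inv² N · h k (suc N)) (h (suc k) N) ⟩
  h (suc k) (suc N) ∎
  where
  open ≡-Reasoning
  cons : ∀ xss → sum (map weight (map (suc N ∷_) xss)) ≡ inv² N · sum (map weight xss)
  cons []         = sym (ℚP.*-zeroʳ (inv² N))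
  cons (xs ∷ xss) = trans (cong (_+_ (inv² N · weight xs)) (cons xss)) (sym (ℚP.*-distribˡ-+ (inv² N) (weight xs) (sum (map weight xss))))

record Parts (k N : ℕ) (as : List ℕ) : Set where
  constructor mkParts
  field
    allPositive : All NonZero as
    descending  : Linked ℕ._≥_ as
    bounded     : All (ℕ._≤ N) as
    hasLength   : length as ≡ k

open Parts

bounded⇒linked : ∀ {N as} → All (ℕ._≤ N) as → Linked ℕ._≥_ as → Linked ℕ._≥_ (N ∷ as)
bounded⇒linked []      _ = [-]
bounded⇒linked (h ∷ _) l = h ∷ l

enumerate-sound : ∀ k N → All (Parts k N) (enumerate k N)
enumerate-sound zero    N       = mkParts [] [] [] refl ∷ []
enumerate-sound (suc k) zero    = []
enumerate-sound (suc k) (suc N) = All.++⁺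
  (All.map⁺ (All.map (λ (mkParts pos desc bnd len) →
    mkParts (_ ∷ pos) (bounded⇒linked bnd desc) (ℕP.≤-refl ∷ bnd) (cong suc len)) (enumerate-sound k (suc N))))
  (All.map (λ (mkParts pos desc bnd len) → mkParts pos desc (All.map ℕP.m≤n⇒m≤1+n bnd) len) (enumerate-sound (suc k) N))

≥-trans : ∀ {i j k} → i ℕ.≥ j → j ℕ.≥ k → i ℕ.≥ k
≥-trans i≥j j≥k = ℕP.≤-trans j≥k i≥j

enumerate-complete : ∀ k N {as} → Parts k N as → as ∈ enumerate k N
enumerate-complete zero    N       {[]}     _ = here refl
enumerate-complete zero    N       {_ ∷ _}  (mkParts _ _ _ ())
enumerate-complete (suc k) N       {[]}     (mkParts _ _ _ ())
enumerate-complete (suc k) zero    {zero ∷ _}  (mkParts (() ∷ _) _ _ _)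
enumerate-complete (suc k) zero    {suc _ ∷ _} (mkParts _ _ (() ∷ _) _)
enumerate-complete (suc k) (suc N) {a ∷ as} (mkParts pos@(_ ∷ pas) desc (a≤ ∷ bnd) len) with ℕP.m≤n⇒m<n∨m≡n a≤
... | inj₂ refl       = ∈-++⁺ˡ (∈-map⁺ (suc N ∷_) (enumerate-complete k (suc N) (mkParts pas (Linked.tail desc) bnd (ℕP.suc-injective len))))
... | inj₁ (ℕ.s≤s a≤N) = ∈-++⁺ʳ (map (suc N ∷_) (enumerate k (suc N)))
  (enumerate-complete (suc k) N (mkParts pos desc (Linked.Linked⇒All ≥-trans a≤N desc) len))

enumerate-unique : ∀ k N → Unique (enumerate k N)
enumerate-unique zero    N       = [] ∷ []
enumerate-unique (suc k) zero    = []
enumerate-unique (suc k) (suc N) = Unique.++⁺ (Unique.map⁺ ∷-injectiveʳ (enumerate-unique k (suc N))) (enumerate-unique (suc k) N) disjoint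
  where
  disjoint : ∀ {as} → as ∈ map (suc N ∷_) (enumerate k (suc N)) × as ∈ enumerate (suc k) N → _
  disjoint (∈₁ , ∈₂) with ∈-map⁻ (suc N ∷_) ∈₁
  ... | _ , _ , refl with All.lookup (enumerate-sound (suc k) N) ∈₂
  ...   | mkParts _ _ (1+N≤N ∷ _) _ = ℕP.1+n≰n 1+N≤N

PartitionOfLength : ℕ → Set
PartitionOfLength k = Σ Partition λ q → ℓ q ≡ k

partsOf : ∀ {k} → PartitionOfLength k → List ℕ
partsOf (q , _) = parts q

NonZero-irrelevant : ∀ {n} (a b : NonZero n) → a ≡ b
NonZero-irrelevant record { nonZero = a } record { nonZero = b } = cong (λ t → record { nonZero = t }) (T-irrelevant a b)

-- Carries `Unique` from partitions over to their lists of parts.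
partsOf-injective : ∀ {k} {q r : PartitionOfLength k} → partsOf q ≡ partsOf r → q ≡ r
partsOf-injective {q = mkPartition as pos desc , len} {mkPartition .as pos′ desc′ , len′} refl
  with refl ← All.irrelevant NonZero-irrelevant pos pos′
     | refl ← Linked.irrelevant ℕP.≤-irrelevant desc desc′
     | refl ← ℕP.≡-irrelevant len len′ = refl

enumeration : ∀ k N → ∃ λ (S : List (PartitionOfLength k)) → map partsOf S ≡ enumerate k N
enumeration k N = lift (enumerate-sound k N)
  where
  lift : ∀ {xss} → All (Parts k N) xss → ∃ λ (S : List (PartitionOfLength k)) → map partsOf S ≡ xss
  lift []         = [] , refl
  lift {xs ∷ _} (px ∷ pxs) = let (S , eq) = lift pxs in
    ((mkPartition xs (allPositive px) (descending px) , hasLength px) ∷ S) , cong (xs ∷_) eq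

upperBound : ∀ as → ∃ λ M → All (ℕ._≤ M) as
upperBound []       = 0 , []
upperBound (a ∷ as) = let (M , h) = upperBound as in
  a ℕ.⊔ M , ℕP.m≤m⊔n a M ∷ All.map (λ le → ℕP.≤-trans le (ℕP.m≤n⊔m a M)) h

upperBound₂ : ∀ ass → ∃ λ M → All (All (ℕ._≤ M)) ass
upperBound₂ []         = 0 , []
upperBound₂ (as ∷ ass) =
  let (M , h)   = upperBound as
      (M′ , h′) = upperBound₂ ass
  in M ℕ.⊔ M′ , All.map (λ le → ℕP.≤-trans le (ℕP.m≤m⊔n M M′)) h
              ∷ All.map (All.map (λ le → ℕP.≤-trans le (ℕP.m≤n⊔m M M′))) h′

term-of : ∀ {k} → PartitionOfLength k → ℚ
term-of (q , _) = (1/ integer q ^ 2) {{integer≢0 q}}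

sum-term-of : ∀ {k} (T : List (PartitionOfLength k)) → sum (map term-of T) ≡ sum (map weight (map partsOf T))
sum-term-of []            = refl
sum-term-of ((q , _) ∷ T) = cong₂ _+_ (1/product^2≡weight (positive q)) (sum-term-of T)

-- All terms are nonnegative, so the sum over a finite T containing S, the partitions with parts at
-- most 2N, lies between two values of `h`: at 2N and at some 2M bounding the parts of T. Both are
-- within ε of x.
ζ𝒫-value : ∀ k x → (λ N → h k (N ℕ.* 2)) ≈ approx x → ζ𝒫[ 2 ^ k ]≔ x
ζ𝒫-value k x h≈x ε 0<ε =
  let (N₁ , near)  = h≈x .close (½ · ε) (0<½* 0<ε)
      (N₂ , close-x) = cauchy x (½ · ε) (0<½* 0<ε)
      N = N₁ ℕ.⊔ N₂
      (S , S≡) = enumeration k (N ℕ.* 2)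
      h-near : ∀ M n → N ℕ.≤ M → N ℕ.≤ n → ∣ h k (M ℕ.* 2) - approx x n ∣ ≤ ε
      h-near = λ M n N≤M N≤n → subst₂ _≤_
        (cong ∣_∣ (solve 3 (λ a b c → (a :- b) :+ (b :- c) := a :- c) refl (h k (M ℕ.* 2)) (approx x M) (approx x n)))
        (½+½ ε)
        (ℚP.≤-trans (ℚP.∣p+q∣≤∣p∣+∣q∣ (h k (M ℕ.* 2) - approx x M) (approx x M - approx x n))
          (ℚP.+-mono-≤ (near M (ℕP.m⊔n≤o⇒m≤o N₁ N₂ N≤M))
            (close-x M n (ℕP.m⊔n≤o⇒n≤o N₁ N₂ N≤M) (ℕP.m⊔n≤o⇒n≤o N₁ N₂ N≤n))))
  in S , λ T T! S⊆T →
    let (M₀ , T≤M₀) = upperBound₂ (map partsOf T)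
        -- M depends on T, but the index from which the estimate holds is N, since `h-near` treats M
        -- and n independently.
        M = N ℕ.⊔ M₀
        lower : h k (N ℕ.* 2) ≤ sum (map term-of T)
        lower = subst₂ _≤_ (sum-enumerate k (N ℕ.* 2)) (sym (sum-term-of T))
          (sum-⊆ weight 0≤weight (enumerate-unique k (N ℕ.* 2))
            (subst (_⊆ map partsOf T) S≡ (⊆.map⁺ partsOf S⊆T)))
        upper : sum (map term-of T) ≤ h k (M ℕ.* 2)
        upper = subst₂ _≤_ (sym (sum-term-of T)) (sum-enumerate k (M ℕ.* 2))
          (sum-⊆ weight 0≤weight (Unique.map⁺ partsOf-injective T!) (T⊆ T M (All.map (All.map λ le →
            ℕP.≤-trans le (ℕP.≤-trans (ℕP.m≤n⊔m N M₀) (n≤n*2 M))) T≤M₀)))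
    in N , λ n N≤n → between lower upper (h-near N n ℕP.≤-refl N≤n) (h-near M n (ℕP.m≤m⊔n N M₀) N≤n)
  where
  T⊆ : ∀ (T : List (PartitionOfLength k)) M → All (All (ℕ._≤ M ℕ.* 2)) (map partsOf T) → map partsOf T ⊆ enumerate k (M ℕ.* 2)
  T⊆ T M bnd as∈ with ∈-map⁻ partsOf as∈
  ... | (q , len) , _ , refl = enumerate-complete k (M ℕ.* 2) (mkParts (positive q) (nonIncreasing q) (All.lookup bnd as∈) len)

-- The coefficient and the explicit values

[2n-1]/n : ∀ n .{{_ : NonZero n}} → + (2 ℕ.* n ℕ.∸ 1) / n ≡ ι 2 - + 1 / n
[2n-1]/n (suc m) = begin
  + (2 ℕ.* suc m ℕ.∸ 1) / suc m                        ≡⟨ /≡ι· (2 ℕ.* suc m ℕ.∸ 1) m ⟩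
  ι (2 ℕ.* suc m ℕ.∸ 1) · inv m                        ≡⟨ cong (_· inv m) 2m-1 ⟩
  (ι (suc m) + ι (suc m) - 1ℚ) · inv m                 ≡⟨ solve 2 (λ a b → (a :+ a :- con 1ℚ) :* b := a :* b :+ a :* b :- b) refl (ι (suc m)) (inv m) ⟩
  ι (suc m) · inv m + ι (suc m) · inv m - inv m        ≡⟨ cong (λ q → q + q - inv m) (ι·inv m) ⟩
  ι 2 - inv m                                          ∎
  where
  open ≡-Reasoning
  2m-1 : ι (2 ℕ.* suc m ℕ.∸ 1) ≡ ι (suc m) + ι (suc m) - 1ℚ
  2m-1 = trans (solve 1 (λ a → a := con 1ℚ :+ a :- con 1ℚ) refl (ι (2 ℕ.* suc m ℕ.∸ 1)))
    (cong (_- 1ℚ) (trans (sym (ι-suc (2 ℕ.* suc m ℕ.∸ 1)))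
      (trans (cong ι (cong (suc m ℕ.+_) (ℕP.+-identityʳ (suc m)))) (ι-+ (suc m) (suc m)))))

η-coefficient : (k : ℕ) → ℚ
η-coefficient k = (+ (2 ℕ.^ (2 ℕ.* k ℕ.∸ 1) ℕ.∸ 1) / 2 ℕ.^ (2 ℕ.* k ℕ.∸ 2)) {{m^n≢0 2 (2 ℕ.* k ℕ.∸ 2)}}

η-coefficient≡c : ∀ k → η-coefficient (suc k) ≡ c k
η-coefficient≡c k = begin
  -- With 2(k + 1) rewritten as 2 + 2k, the truncated subtractions in the exponents compute.
  η-coefficient (suc k)                                           ≡⟨ cong (λ e → (+ (2 ℕ.^ (e ℕ.∸ 1) ℕ.∸ 1) / 2 ℕ.^ (e ℕ.∸ 2)) {{m^n≢0 2 (e ℕ.∸ 2)}}) (ℕP.*-suc 2 k) ⟩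
  (+ (2 ℕ.* 2 ℕ.^ (2 ℕ.* k) ℕ.∸ 1) / 2 ℕ.^ (2 ℕ.* k)) {{nz}}      ≡⟨ [2n-1]/n (2 ℕ.^ (2 ℕ.* k)) {{nz}} ⟩
  ι 2 - 1/ 2 ^ (2 ℕ.* k)                                          ≡⟨ cong (λ q → ι 2 - q) (trans (1/^≡inv↑ 1 (2 ℕ.* k)) (↑-double (inv 1) k)) ⟩
  c k                                                             ∎
  where
  open ≡-Reasoning
  nz = m^n≢0 2 (2 ℕ.* k)

ζ𝒫-even : (k : ℕ) .{{_ : NonZero k}} → ζ𝒫[ 2 ^ k ]≔ (fromℚ (η-coefficient k) * ζ (2 ℕ.* k) {{2*k-nonTrivial k}})
ζ𝒫-even (suc k) = ζ𝒫-value (suc k) (fromℚ (η-coefficient (suc k)) * ζ (2 ℕ.* suc k) {{2*k-nonTrivial (suc k)}})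
  (≈-trans (h-limit k) (≈-reflexive λ N → cong₂ _·_ (sym (η-coefficient≡c k)) (sym (ζ-partialSum≡p (suc k) N))))

-- ζ (2 (k + 1)) = r k · π^(2 (k + 1)) for k ≤ 12; the value beyond is junk.
r : ℕ → ℚ
r 0  = + 1 / 6
r 1  = + 1 / 90
r 2  = + 1 / 945
r 3  = + 1 / 9450
r 4  = + 1 / 93555
r 5  = + 691 / 638512875
r 6  = + 2 / 18243225
r 7  = + 3617 / 325641566250
r 8  = + 43867 / 38979295480125
r 9  = + 174611 / 1531329465290625
r 10 = + 155366 / 13447856940643125
r 11 = + 236364091 / 201919571963756521875
r 12 = + 1315862 / 11094481976030578125
r _  = 0ℚ

-- Since c (k + 1) = 2 - ¼ ↑ (k + 1) is at least 1, the coefficient is at least 2 · 1 - 1.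
coefficient≢0 : ∀ k → ℚ.NonZero (ι (suc (suc k)) · c (suc k) - 1ℚ)
coefficient≢0 k = ℚP.pos⇒nonZero (ι (suc (suc k)) · c (suc k) - 1ℚ) {{ℚ.positive (ℚP.<-≤-trans (ℚP.positive⁻¹ 1ℚ)
  (ℚP.+-monoˡ-≤ (- 1ℚ) (*-mono-≤ (ι 2) (ι (suc (suc k))) 1ℚ (c (suc k)) (ℚP.nonNegative⁻¹ 1ℚ) (0≤ι (suc (suc k))) (ι-mono {2} {suc (suc k)} (ℕ.s≤s (ℕ.s≤s ℕ.z≤n)))
    (ℚP.+-monoʳ-≤ (ι 2) (ℚP.neg-antimono-≤ (↑≤1 (suc k) (ℚP.nonNegative⁻¹ ¼) (inv-anti {0} {3} ℕ.z≤n)))))))}}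

-- Twelve equations between concrete rationals, settled by evaluation; they certify the table `r`
-- beyond its first entry.
r-recursion : ∀ k → k ℕ.< 12 → (ι (suc (suc k)) · c (suc k) - 1ℚ) · r (suc k) ≡ conv r (λ j → c j · r j) k
r-recursion k k<12 = from-yes (ℕP.allUpTo? (λ k → (ι (suc (suc k)) · c (suc k) - 1ℚ) · r (suc k) ℚP.≟ conv r (λ j → c j · r j) k) 12) k<12

approx-^ : ∀ x n N → approx (x ^ n) N ≡ approx x N ↑ n
approx-^ x zero    N = refl
approx-^ x (suc n) N = cong (approx x N ·_) (approx-^ x n N)

ζ-even : ∀ k → k ℕ.≤ 12 → ∀ q s → q · r k ≡ s →
  fromℚ q * ζ (2 ℕ.* suc k) {{2*k-nonTrivial (suc k)}} ≃ fromℚ s * π ^ (2 ℕ.* suc k)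
ζ-even k k≤12 q s qr≡s = close $
  ≈-trans (≈-reflexive λ N → cong (q ·_) (ζ-partialSum≡p (suc k) N)) $
  ≈-trans (scale q (EvenZeta.even r refl 12 coefficient≢0 r-recursion k k≤12)) $
  ≈-reflexive λ N → trans (sym (ℚP.*-assoc q (r k) (π²ₙ N ↑ suc k)))
    (cong₂ _·_ qr≡s (sym (trans (approx-^ π (2 ℕ.* suc k) N) (↑-double (πₙ N) (suc k)))))

-- The argument t of ζ is kept abstract: comparing, say, ζ (2 · 13) with ζ 26 by conversion
-- unfolds their Cauchy proofs.
ζ𝒫-example : ∀ k t q s .{{_ : NonTrivial t}} → k ℕ.≤ 12 → 2 ℕ.* suc k ≡ t → η-coefficient (suc k) ≡ q → q · r k ≡ s →
  ζ𝒫[ 2 ^ suc k ]≔ (fromℚ q * ζ t) × fromℚ q * ζ t ≃ fromℚ s * π ^ t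
ζ𝒫-example k _ q s k≤12 refl refl qr≡s = ζ𝒫-even (suc k) , ζ-even k k≤12 q s qr≡s

corollary2p4 :
    ((k : ℕ) .{{_ : NonZero k}} →
      ζ𝒫[ 2 ^ k ]≔ (fromℚ ((+ (2 ℕ.^ (2 ℕ.* k ℕ.∸ 1) ℕ.∸ 1) / (2 ℕ.^ (2 ℕ.* k ℕ.∸ 2))) {{m^n≢0 2 (2 ℕ.* k ℕ.∸ 2)}}) * ζ (2 ℕ.* k) {{2*k-nonTrivial k}}))
    × (ζ𝒫[ 2 ^ 1 ]≔ ζ 2
      × ζ 2 ≃ fromℚ (+ 1 / 6) * π ^ 2)
    × (ζ𝒫[ 2 ^ 2 ]≔ (fromℚ (+ 7 / 4) * ζ 4)
      × fromℚ (+ 7 / 4) * ζ 4 ≃ fromℚ (+ 7 / 360) * π ^ 4)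
    × (ζ𝒫[ 2 ^ 3 ]≔ (fromℚ (+ 31 / 16) * ζ 6)
      × fromℚ (+ 31 / 16) * ζ 6 ≃ fromℚ (+ 31 / 15120) * π ^ 6)
    × (ζ𝒫[ 2 ^ 13 ]≔ (fromℚ (+ 33554431 / 16777216) * ζ 26)
      × fromℚ (+ 33554431 / 16777216) * ζ 26 ≃ fromℚ (+ 22076500342261 / 93067260259985915904000000) * π ^ 26)
corollary2p4 = ζ𝒫-even
  -- Here ζ 2 stands without a factor, so this case bypasses `ζ𝒫-example`; `c 0` computes to 1.
  , (ζ𝒫-value 1 (ζ 2) (≈-trans (h-limit 0) (≈-reflexive λ N → trans (ℚP.*-identityˡ (p 1 N)) (sym (ζ-partialSum≡p 1 N))))
    , close (≈-trans (≈-reflexive (ζ-partialSum≡p 1)) (≈-trans basel (≈-reflexive λ N →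
        cong (+ 1 / 6 ·_) (sym (cong (πₙ N ·_) (ℚP.*-identityʳ (πₙ N))))))))
  , ζ𝒫-example 1 4 (+ 7 / 4) (+ 7 / 360) (ℕP.m≤m+n 1 11) refl refl refl
  , ζ𝒫-example 2 6 (+ 31 / 16) (+ 31 / 15120) (ℕP.m≤m+n 2 10) refl refl refl
  , ζ𝒫-example 12 26 (+ 33554431 / 16777216) (+ 22076500342261 / 93067260259985915904000000) (ℕP.m≤m+n 12 0) refl refl refl
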